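{- Let $A$ be a finite alphabet with $|A|\ge 2$. The problem of deciding, given a system $(\mathcal S,\mathcal U)$ of sat- and unsat-equations over $A$, whether $(\mathcal S,\mathcal U)$ is satisfiable over $A$, is undecidable.
   Context: Let $X$ and $Y$ be disjoint alphabets of variables (disjoint from $A$). A system of sat- and unsat-equations over $A$ is a pair $(\mathcal S,\mathcal U)$ of finite sets $\mathcal S=\{e_1,\ldots,e_n\}$, $\mathcal U=\{f_1,\ldots,f_m\}$, where each $e_i$ is $U_i=V_i$ or $\lnot(U_i=V_i)$ with $U_i,V_i\in(A\cup X)^*$, and each $f_i$ is $U_i'=V_i'$ or $\lnot(U_i'=V_i')$ with $U_i',V_i'\in(A\cup X\cup Y)^*$. It is satisfiable over $A$ if there is an assignment of the variables of $X$ to words of $A^*$ that satisfies all $e_i\in\mathcal S$ and such that for all assignments of the variables of $Y$ to words of $A^*$ at least one $f_j\in\mathcal U$ is not satisfied. (An assignment is extended to a morphism fixing every letter of $A$; it satisfies $U=V$ if the images of $U$ and $V$ are equal.) -}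

module Defs where

open import Data.Fin using (Fin; toℕ)
open import Data.Fin.Properties using (toℕ-injective)
open import Data.List using (List; []; _∷_; [_]; concatMap)
open import Data.List.Relation.Unary.All using (All)
open import Data.List.Relation.Unary.Any using (Any)
open import Data.Nat using (ℕ; zero; suc; _*_; _^_; _<_)
open import Data.Nat.Properties
  using (suc-injective; *-cancelˡ-≡; *-assoc; *-identityˡ; even≢odd; m*n≡0⇒m≡0∨n≡0; m^n≡0⇒m≡0)
open import Data.Product using (_×_; _,_; ∃; Σ-syntax)
open import Data.Sum using (_⊎_; inj₁; inj₂; [_,_]′)
open import Data.Vec using (Vec; []; _∷_; lookup)
open import Data.Vec.Relation.Binary.Pointwise.Inductive using (Pointwise)
open import Function using (id; _∘_)
open import Function.Bundles using (_↔_; Inverse)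
open import Function.Definitions using (Injective)
open import Relation.Binary.PropositionalEquality using (_≡_; _≢_; refl; sym; trans; cong; cong₂)
open import Relation.Nullary using (¬_; contradiction)

-- Kleene's schemes; Rec n denotes partial functions ℕⁿ ⇀ ℕ.
data Rec : ℕ → Set where
  zeroᵣ : Rec 0
  sucᵣ  : Rec 1
  projᵣ : ∀ {n} → Fin n → Rec n
  compᵣ : ∀ {m n} → Rec m → Vec (Rec n) m → Rec n
  precᵣ : ∀ {n} → Rec n → Rec (suc (suc n)) → Rec (suc n)
  minᵣ  : ∀ {n} → Rec (suc n) → Rec n

infix 4 _[_]⇓_

-- f [ xs ]⇓ y : the partial function f is defined at xs, with value y.
data _[_]⇓_ : ∀ {n} → Rec n → Vec ℕ n → ℕ → Set where
  zero⇓   : zeroᵣ [ [] ]⇓ 0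
  suc⇓    : ∀ {x} → sucᵣ [ x ∷ [] ]⇓ suc x
  proj⇓   : ∀ {n} {i : Fin n} {xs} → projᵣ i [ xs ]⇓ lookup xs i
  comp⇓   : ∀ {m n} {f : Rec m} {gs : Vec (Rec n) m} {xs ys z} →
            Pointwise (λ g y → g [ xs ]⇓ y) gs ys →
            f [ ys ]⇓ z →
            compᵣ f gs [ xs ]⇓ z
  prec⇓-0 : ∀ {n} {g : Rec n} {h xs y} →
            g [ xs ]⇓ y →
            precᵣ g h [ 0 ∷ xs ]⇓ y
  prec⇓-s : ∀ {n} {g : Rec n} {h xs k y z} →
            precᵣ g h [ k ∷ xs ]⇓ y →
            h [ k ∷ y ∷ xs ]⇓ z →
            precᵣ g h [ suc k ∷ xs ]⇓ z
  min⇓    : ∀ {n} {f : Rec (suc n)} {xs y} →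
            f [ y ∷ xs ]⇓ 0 →
            (∀ {z} → z < y → ∃ λ v → f [ z ∷ xs ]⇓ suc v) →
            minᵣ f [ xs ]⇓ y

-- A problem P on instances coded as numbers is decidable when some partial
-- recursive function computes its characteristic function on codes.  Nothing
-- is required of that function on numbers that are not codes.
Decidable : {I : Set} → (I → ℕ) → (I → Set) → Set
Decidable {I} code P =
  Σ[ f ∈ Rec 1 ] ((i : I) →
    (P i → f [ code i ∷ [] ]⇓ 1) × (¬ P i → f [ code i ∷ [] ]⇓ 0))

Undecidable : {I : Set} → (I → ℕ) → (I → Set) → Set
Undecidable code P = ¬ Decidable code P

Pattern : Set → Set → Set
Pattern A V = List (A ⊎ V)

infix 5 _≐_ _≐̸_

data Literal (A V : Set) : Set where
  _≐_ _≐̸_ : Pattern A V → Pattern A V → Literal A V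

-- The morphism (A ∪ V)* → A* extending σ and fixing the letters.
extend : {A V : Set} → (V → List A) → Pattern A V → List A
extend σ = concatMap [ [_] , σ ]′

infix 4 _⊨_

_⊨_ : {A V : Set} → (V → List A) → Literal A V → Set
σ ⊨ U ≐ V  = extend σ U ≡ extend σ V
σ ⊨ U ≐̸ V = extend σ U ≢ extend σ V

-- Countable supplies of variables; they are made disjoint by _⊎_.
X Y : Set
X = ℕ
Y = ℕ

-- The finite sets of literals are presented as lists.
record System (A : Set) : Set where
  constructor system
  field
    sat   : List (Literal A X)
    unsat : List (Literal A (X ⊎ Y))

Satisfiable : {A : Set} → System A → Set
Satisfiable {A} (system S U) =
  Σ[ σ ∈ (X → List A) ]
    (All (σ ⊨_) S × ((τ : Y → List A) → Any (λ f → ¬ ([ σ , τ ]′ ⊨ f)) U))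

-- A bijection from ℕ × ℕ onto the positive numbers.
pair : ℕ → ℕ → ℕ
pair m n = 2 ^ m * suc (2 * n)

code-⊎ : {A B : Set} → (A → ℕ) → (B → ℕ) → A ⊎ B → ℕ
code-⊎ f g (inj₁ a) = 2 * f a
code-⊎ f g (inj₂ b) = suc (2 * g b)

code-List : {A : Set} → (A → ℕ) → List A → ℕ
code-List f []       = 0
code-List f (x ∷ xs) = pair (f x) (code-List f xs)

module _ {A : Set} {k : ℕ} (enum : A ↔ Fin k) where

  code-letter : A → ℕ
  code-letter = toℕ ∘ Inverse.to enum

  code-Pattern : {V : Set} → (V → ℕ) → Pattern A V → ℕ
  code-Pattern v = code-List (code-⊎ code-letter v)

  code-Literal : {V : Set} → (V → ℕ) → Literal A V → ℕ
  code-Literal v (U ≐ V)  = pair 0 (pair (code-Pattern v U) (code-Pattern v V))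
  code-Literal v (U ≐̸ V) = pair 1 (pair (code-Pattern v U) (code-Pattern v V))

  code-System : System A → ℕ
  code-System (system S U) =
    pair (code-List (code-Literal id) S)
         (code-List (code-Literal (code-⊎ id id)) U)

-- The coding is injective, so no two systems are forced to share an answer.
pair≢0 : ∀ m n → pair m n ≢ 0
pair≢0 m n eq with m*n≡0⇒m≡0∨n≡0 (2 ^ m) eq
... | inj₁ p = contradiction (m^n≡0⇒m≡0 2 m p) λ ()
... | inj₂ ()

pair-suc : ∀ m n → pair (suc m) n ≡ 2 * pair m n
pair-suc m n = *-assoc 2 (2 ^ m) (suc (2 * n))

pair-zero : ∀ n → pair 0 n ≡ suc (2 * n)
pair-zero n = *-identityˡ (suc (2 * n))

pair-injective : ∀ m m′ n n′ → pair m n ≡ pair m′ n′ → m ≡ m′ × n ≡ n′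
pair-injective zero zero n n′ eq =
  refl , *-cancelˡ-≡ n n′ 2 (suc-injective (trans (sym (pair-zero n)) (trans eq (pair-zero n′))))
pair-injective zero (suc m′) n n′ eq =
  contradiction (trans (sym (pair-suc m′ n′)) (trans (sym eq) (pair-zero n))) (even≢odd (pair m′ n′) n)
pair-injective (suc m) zero n n′ eq =
  contradiction (trans (sym (pair-suc m n)) (trans eq (pair-zero n′))) (even≢odd (pair m n) n′)
pair-injective (suc m) (suc m′) n n′ eq
  with pair-injective m m′ n n′ (*-cancelˡ-≡ (pair m n) (pair m′ n′) 2
         (trans (sym (pair-suc m n)) (trans eq (pair-suc m′ n′))))
... | refl , q = refl , q

code-⊎-injective : {A B : Set} {f : A → ℕ} {g : B → ℕ} →
                   Injective _≡_ _≡_ f → Injective _≡_ _≡_ g →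
                   Injective _≡_ _≡_ (code-⊎ f g)
code-⊎-injective f-inj g-inj {inj₁ _} {inj₁ _} eq = cong inj₁ (f-inj (*-cancelˡ-≡ _ _ 2 eq))
code-⊎-injective {f = f} {g} f-inj g-inj {inj₁ a} {inj₂ b} eq = contradiction eq (even≢odd (f a) (g b))
code-⊎-injective {f = f} {g} f-inj g-inj {inj₂ b} {inj₁ a} eq = contradiction (sym eq) (even≢odd (f a) (g b))
code-⊎-injective f-inj g-inj {inj₂ _} {inj₂ _} eq = cong inj₂ (g-inj (*-cancelˡ-≡ _ _ 2 (suc-injective eq)))

code-List-injective : {A : Set} {f : A → ℕ} →
                      Injective _≡_ _≡_ f → Injective _≡_ _≡_ (code-List f)
code-List-injective {f = f} f-inj {[]}     {[]}     eq = refl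
code-List-injective {f = f} f-inj {[]}     {y ∷ ys} eq = contradiction (sym eq) (pair≢0 (f y) (code-List f ys))
code-List-injective {f = f} f-inj {x ∷ xs} {[]}     eq = contradiction eq (pair≢0 (f x) (code-List f xs))
code-List-injective {f = f} f-inj {x ∷ xs} {y ∷ ys} eq
  with p , q ← pair-injective (f x) (f y) (code-List f xs) (code-List f ys) eq =
  cong₂ _∷_ (f-inj p) (code-List-injective f-inj q)

module _ {A : Set} {k : ℕ} (enum : A ↔ Fin k) where

  code-letter-injective : Injective _≡_ _≡_ (code-letter enum)
  code-letter-injective {a} {b} eq =
    trans (sym (Inverse.strictlyInverseʳ enum a))
      (trans (cong (Inverse.from enum) (toℕ-injective eq))
             (Inverse.strictlyInverseʳ enum b))

  code-Pattern-injective : {V : Set} {v : V → ℕ} → Injective _≡_ _≡_ v →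
                           Injective _≡_ _≡_ (code-Pattern enum v)
  code-Pattern-injective v-inj =
    code-List-injective (code-⊎-injective code-letter-injective v-inj)

  code-Literal-injective : {V : Set} {v : V → ℕ} → Injective _≡_ _≡_ v →
                           Injective _≡_ _≡_ (code-Literal enum v)
  code-Literal-injective {v = v} v-inj {l} {l′} eq = go l l′ eq
    where
    ⌜_⌝ = code-Pattern enum v

    go : ∀ l l′ → code-Literal enum v l ≡ code-Literal enum v l′ → l ≡ l′
    go (U ≐ V) (U′ ≐ V′) eq
      with _ , r ← pair-injective 0 0 (pair ⌜ U ⌝ ⌜ V ⌝) (pair ⌜ U′ ⌝ ⌜ V′ ⌝) eq
      with p , q ← pair-injective ⌜ U ⌝ ⌜ U′ ⌝ ⌜ V ⌝ ⌜ V′ ⌝ r =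
      cong₂ _≐_ (code-Pattern-injective v-inj p) (code-Pattern-injective v-inj q)
    go (U ≐̸ V) (U′ ≐̸ V′) eq
      with _ , r ← pair-injective 1 1 (pair ⌜ U ⌝ ⌜ V ⌝) (pair ⌜ U′ ⌝ ⌜ V′ ⌝) eq
      with p , q ← pair-injective ⌜ U ⌝ ⌜ U′ ⌝ ⌜ V ⌝ ⌜ V′ ⌝ r =
      cong₂ _≐̸_ (code-Pattern-injective v-inj p) (code-Pattern-injective v-inj q)
    go (U ≐ V) (U′ ≐̸ V′) eq
      with () , _ ← pair-injective 0 1 (pair ⌜ U ⌝ ⌜ V ⌝) (pair ⌜ U′ ⌝ ⌜ V′ ⌝) eq
    go (U ≐̸ V) (U′ ≐ V′) eq
      with () , _ ← pair-injective 1 0 (pair ⌜ U ⌝ ⌜ V ⌝) (pair ⌜ U′ ⌝ ⌜ V′ ⌝) eq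

  code-System-injective : Injective _≡_ _≡_ (code-System enum)
  code-System-injective {system S U} {system S′ U′} eq = go
    (pair-injective (code-List (code-Literal enum id) S) (code-List (code-Literal enum id) S′)
                    (code-List (code-Literal enum (code-⊎ id id)) U)
                    (code-List (code-Literal enum (code-⊎ id id)) U′) eq)
    where
    go : code-List (code-Literal enum id) S ≡ code-List (code-Literal enum id) S′ ×
         code-List (code-Literal enum (code-⊎ id id)) U ≡
         code-List (code-Literal enum (code-⊎ id id)) U′ →
         system S U ≡ system S′ U′
    go (p , q) = cong₂ system
      (code-List-injective (code-Literal-injective id) p)
      (code-List-injective (code-Literal-injective (code-⊎-injective id id)) q)

{-# OPTIONS --safe #-}
module Submission where

-- A decision procedure f would make the set of satisfiable systems recursive, so there would be
-- a partial recursive h defined at (s , u) exactly when f rejects the system with codes s and u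
-- whose first two input variables are set to aˢ and aᵘ.  Halting of h is itself expressed by such
-- a system; feeding it its own codes contradicts f.
--
-- Halting of h is derivability in a Horn program over ℕ with linear terms.  A derivation is
-- written as a list of records (index, rule, indices of the premises, values of the rule's
-- variables), and this as the word x = b a^n₁ b a^n₂ … b, an existential variable.  Correctness
-- of the list says that all records and pairs of linked records found in x satisfy a positive
-- combination of linear equations: universal variables range over the positions in x and over
-- words commuting with a, that is, over numbers.  Clauses E₁ → F₁ and E₂ → F₂ in distinct
-- universal variables merge into E₁ ∧ E₂ → F₁ ∧ F₂ because E₁ and E₂ are kept satisfiable.

open import Data.Bool using (Bool; true; false)
open import Data.Fin as Fin using (Fin; zero; suc; toℕ; _↑ˡ_; _↑ʳ_; inject≤; combine; remQuot)
open import Data.Fin.Patterns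
open import Data.Fin.Properties as Fin using (toℕ-injective)
open import Data.List as List
  using (List; []; _∷_; [_]; _++_; map; tabulate; length; replicate; cartesianProductWith; concat)
open import Data.List.Membership.Propositional using (_∈_; _∉_)
open import Data.List.Membership.Propositional.Properties
  using (∈-++⁺ˡ; ∈-++⁺ʳ; ∈-++⁻; ∈-∃++; ∈-lookup; ∈-tabulate⁺; ∈-tabulate⁻)
open import Data.List.Properties
  using (map-tabulate; tabulate-cong; map-++; map-∘; map-cong; ∷-injective; ∷-injectiveˡ; ∷-injectiveʳ;
         length-tabulate; length-++; length-replicate; ++-assoc; ++-identityʳ; ++-conicalʳ; concatMap-++; ≡-dec)
open import Data.List.Relation.Binary.Subset.Propositional using (_⊆_)
open import Data.List.Relation.Unary.All as All using (All; []; _∷_)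
import Data.List.Relation.Unary.All.Properties as All
open import Data.List.Relation.Unary.Any as Any using (Any; here; there)
import Data.List.Relation.Unary.Any.Properties as Any
open import Data.Nat hiding (_≟_)
open import Data.Nat.ListAction using (sum)
open import Data.Nat.Properties hiding (_≟_)
open import Data.Product hiding (map)
open import Data.Sum using (_⊎_; inj₁; inj₂; [_,_]′)
open import Data.Unit using (⊤; tt)
open import Data.Vec as Vec using (Vec; []; _∷_; lookup)
open import Data.Vec.Functional using () renaming (_∷_ to _∷ᶠ_)
open import Data.Vec.Properties using (lookup-++ˡ; lookup-++ʳ; lookup∘tabulate)
open import Data.Vec.Relation.Binary.Pointwise.Inductive using (Pointwise; []; _∷_)
open import Function using (_∘_; id)
open import Function.Bundles using (_↔_; Inverse)
open import Function.Definitions using (Injective)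
open import Relation.Binary.Definitions using (DecidableEquality; tri<; tri≈; tri>)
open import Relation.Binary.PropositionalEquality hiding ([_])
open import Relation.Nullary using (¬_; contradiction; Dec; yes; no; ¬?)
open import Relation.Nullary.Decidable using (decidable-stable; map′)
open import Defs

-- The form of the proof is dictated by the quantifiers available. After the existential choice of
-- `x` and its companions there is one block of universal quantifiers and a single clause: some
-- literal of `unsat` fails. Equations among its literals therefore act as hypotheses and negated
-- equations as alternative conclusions, so each alternative has to be one equation of words. No
-- existential quantifier follows the universal ones, hence the condition cannot say that a record
-- pointed to exists. Existence comes instead from indices that drop by one down to 0, since every
-- smaller index then occurs; and inequalities between indices become equations thanks to the slacks
-- stored in the records. Concatenating powers of a only adds numbers. This is why the rules are
-- confined to linear terms and every other operation is left to recursion through rules.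

mutual
  ⇓-functional : ∀ {n} {f : Rec n} {xs y z} → f [ xs ]⇓ y → f [ xs ]⇓ z → y ≡ z
  ⇓-functional zero⇓ zero⇓ = refl
  ⇓-functional suc⇓ suc⇓ = refl
  ⇓-functional proj⇓ proj⇓ = refl
  ⇓-functional (comp⇓ ps p) (comp⇓ qs q) with refl ← ⇓-functional* ps qs = ⇓-functional p q
  ⇓-functional (prec⇓-0 p) (prec⇓-0 q) = ⇓-functional p q
  ⇓-functional (prec⇓-s p p′) (prec⇓-s q q′) with refl ← ⇓-functional p q = ⇓-functional p′ q′
  ⇓-functional {y = y} {z} (min⇓ p p<) (min⇓ q q<) with <-cmp y z
  ... | tri≈ _ y≡z _ = y≡z
  ... | tri< y<z _ _ with () ← ⇓-functional p (proj₂ (q< y<z))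
  ... | tri> _ _ z<y with () ← ⇓-functional (proj₂ (p< z<y)) q

  ⇓-functional* : ∀ {m n} {gs : Vec (Rec n) m} {xs ys zs} →
    Pointwise (λ g y → g [ xs ]⇓ y) gs ys → Pointwise (λ g y → g [ xs ]⇓ y) gs zs → ys ≡ zs
  ⇓-functional* [] [] = refl
  ⇓-functional* (p ∷ ps) (q ∷ qs) = cong₂ _∷_ (⇓-functional p q) (⇓-functional* ps qs)

-- Arithmetic of codes by partial recursive functions

constᵣ : ∀ {n} → ℕ → Rec n
constᵣ zero    = compᵣ zeroᵣ []
constᵣ (suc c) = compᵣ sucᵣ (constᵣ c ∷ [])

const⇓ : ∀ {n} c {xs : Vec ℕ n} → constᵣ c [ xs ]⇓ c
const⇓ zero    = comp⇓ [] zero⇓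
const⇓ (suc c) = comp⇓ (const⇓ c ∷ []) suc⇓

addᵣ mulᵣ pairᵣ : Rec 2
powᵣ : Rec 1
addᵣ  = precᵣ (projᵣ 0F) (compᵣ sucᵣ (projᵣ 1F ∷ []))
mulᵣ  = precᵣ (constᵣ 0) (compᵣ addᵣ (projᵣ 2F ∷ projᵣ 1F ∷ []))
powᵣ  = precᵣ (constᵣ 1) (compᵣ mulᵣ (constᵣ 2 ∷ projᵣ 1F ∷ []))
pairᵣ = compᵣ mulᵣ (compᵣ powᵣ (projᵣ 0F ∷ []) ∷
                    compᵣ sucᵣ (compᵣ mulᵣ (constᵣ 2 ∷ projᵣ 1F ∷ []) ∷ []) ∷ [])

add⇓ : ∀ m n → addᵣ [ m ∷ n ∷ [] ]⇓ (m + n)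
add⇓ zero    n = prec⇓-0 proj⇓
add⇓ (suc m) n = prec⇓-s (add⇓ m n) (comp⇓ (proj⇓ ∷ []) suc⇓)

mul⇓ : ∀ m n → mulᵣ [ m ∷ n ∷ [] ]⇓ (m * n)
mul⇓ zero    n = prec⇓-0 (const⇓ 0)
mul⇓ (suc m) n = prec⇓-s (mul⇓ m n) (comp⇓ (proj⇓ ∷ proj⇓ ∷ []) (add⇓ n (m * n)))

pow⇓ : ∀ m → powᵣ [ m ∷ [] ]⇓ (2 ^ m)
pow⇓ zero    = prec⇓-0 (const⇓ 1)
pow⇓ (suc m) = prec⇓-s (pow⇓ m) (comp⇓ (const⇓ 2 ∷ proj⇓ ∷ []) (mul⇓ 2 (2 ^ m)))

pair⇓ : ∀ m n → pairᵣ [ m ∷ n ∷ [] ]⇓ pair m n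
pair⇓ m n = comp⇓ (comp⇓ (proj⇓ ∷ []) (pow⇓ m) ∷
                   comp⇓ (comp⇓ (const⇓ 2 ∷ proj⇓ ∷ []) (mul⇓ 2 n) ∷ []) suc⇓ ∷ [])
                  (mul⇓ (2 ^ m) (suc (2 * n)))

-- Horn programs for recursive functions

infixl 6 _⊕_

data Lin (V : Set) : Set where
  lit : ℕ → Lin V
  var : V → Lin V
  _⊕_ : Lin V → Lin V → Lin V

val : {V : Set} → (V → ℕ) → Lin V → ℕ
val θ (lit n) = n
val θ (var v) = θ v
val θ (t ⊕ u) = val θ t + val θ u

record Rule : Set where
  constructor rule
  field
    arity : ℕ
    head body₁ body₂ : List (Lin (Fin arity))
open Rule public

-- Every rule has exactly two premises, so that all records get two pointers. A missing premise is
-- the empty atom `[]`, which `axiom` supplies.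
data Derivable (R : List Rule) : List ℕ → Set where
  axiom : Derivable R []
  infer : ∀ {r c p q} → r ∈ R → (θ : Fin (arity r) → ℕ) →
          map (val θ) (head r) ≡ c → map (val θ) (body₁ r) ≡ p → map (val θ) (body₂ r) ≡ q →
          Derivable R p → Derivable R q → Derivable R c

-- misses f holds of (y ∷ xs) when f takes positive values at all z ∷ xs with z < y.
data Judgment : Set where
  eval   : ∀ {n} → Rec n → Judgment
  evals  : ∀ {m n} → Vec (Rec n) m → Judgment
  misses : ∀ {n} → Rec (suc n) → Judgment

child : Bool → Judgment → Judgment
child false (eval (compᵣ f gs)) = eval f
child true  (eval (compᵣ f gs)) = evals gs
child false (eval (precᵣ g h))  = eval g
child true  (eval (precᵣ g h))  = eval h
child false (eval (minᵣ f))     = eval f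
child true  (eval (minᵣ f))     = misses f
child false (evals (g ∷ gs))    = eval g
child true  (evals (g ∷ gs))    = evals gs
child _     j                   = j

-- The predicate symbols of the Horn program of f are the positions in the tree of judgments
-- below eval f, read from the position up to the root.
Path : Set
Path = List Bool

bit : Bool → ℕ
bit false = 0
bit true  = 1

bit-injective : Injective _≡_ _≡_ bit
bit-injective {false} {false} _ = refl
bit-injective {true}  {true}  _ = refl

tag : Path → ℕ
tag = code-List bit

vars : ∀ {n k} → (Fin n → Fin k) → List (Lin (Fin k))
vars ι = tabulate (var ∘ ι)

-- After the tag, an atom lists value and arguments for `eval`, values and arguments for `evals`,
-- bound and arguments for `misses`. The last predicate exists because a Horn rule cannot quantify
-- over all numbers below a bound: minimisation becomes a recursion on it.
rules : ∀ {n} → Rec n → Path → List Rule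
rules* : ∀ {m n} → Vec (Rec n) m → Path → List Rule

rules zeroᵣ p = rule 0 (lit (tag p) ∷ lit 0 ∷ []) [] [] ∷ []
rules sucᵣ  p = rule 1 (lit (tag p) ∷ lit 1 ⊕ var 0F ∷ var 0F ∷ []) [] [] ∷ []
rules {n} (projᵣ i) p = rule n (lit (tag p) ∷ var i ∷ vars id) [] [] ∷ []
rules {n} (compᵣ {m} f gs) p =
  rule (1 + (m + n))
    (lit (tag p) ∷ var 0F ∷ vars (λ i → 1 ↑ʳ (m ↑ʳ i)))
    (lit (tag (false ∷ p)) ∷ var 0F ∷ vars (λ i → 1 ↑ʳ (i ↑ˡ n)))
    (lit (tag (true ∷ p)) ∷ vars (λ i → 1 ↑ʳ (i ↑ˡ n)) ++ vars (λ i → 1 ↑ʳ (m ↑ʳ i)))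
  ∷ rules f (false ∷ p) ++ rules* gs (true ∷ p)
rules (precᵣ {n} g h) p =
  rule (1 + n)
    (lit (tag p) ∷ var 0F ∷ lit 0 ∷ vars (1 ↑ʳ_))
    (lit (tag (false ∷ p)) ∷ var 0F ∷ vars (1 ↑ʳ_))
    []
  ∷ rule (3 + n)
    (lit (tag p) ∷ var 0F ∷ lit 1 ⊕ var 1F ∷ vars (3 ↑ʳ_))
    (lit (tag p) ∷ var 2F ∷ var 1F ∷ vars (3 ↑ʳ_))
    (lit (tag (true ∷ p)) ∷ var 0F ∷ var 1F ∷ var 2F ∷ vars (3 ↑ʳ_))
  ∷ rules g (false ∷ p) ++ rules h (true ∷ p)
rules {n} (minᵣ f) p =
  rule (1 + n)
    (lit (tag p) ∷ var 0F ∷ vars (1 ↑ʳ_))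
    (lit (tag (false ∷ p)) ∷ lit 0 ∷ var 0F ∷ vars (1 ↑ʳ_))
    (lit (tag (true ∷ p)) ∷ var 0F ∷ vars (1 ↑ʳ_))
  ∷ rule n
    (lit (tag (true ∷ p)) ∷ lit 0 ∷ vars id)
    [] []
  ∷ rule (2 + n)
    (lit (tag (true ∷ p)) ∷ lit 1 ⊕ var 0F ∷ vars (2 ↑ʳ_))
    (lit (tag (true ∷ p)) ∷ var 0F ∷ vars (2 ↑ʳ_))
    (lit (tag (false ∷ p)) ∷ lit 1 ⊕ var 1F ∷ var 0F ∷ vars (2 ↑ʳ_))
  ∷ rules f (false ∷ p)

rules* {n = n} [] p = rule n (lit (tag p) ∷ vars id) [] [] ∷ []
rules* {suc m} {n} (g ∷ gs) p =
  rule (1 + (m + n))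
    (lit (tag p) ∷ var 0F ∷ vars (λ i → 1 ↑ʳ (i ↑ˡ n)) ++ vars (λ i → 1 ↑ʳ (m ↑ʳ i)))
    (lit (tag (false ∷ p)) ∷ var 0F ∷ vars (λ i → 1 ↑ʳ (m ↑ʳ i)))
    (lit (tag (true ∷ p)) ∷ vars (λ i → 1 ↑ʳ (i ↑ˡ n)) ++ vars (λ i → 1 ↑ʳ (m ↑ʳ i)))
  ∷ rules g (false ∷ p) ++ rules* gs (true ∷ p)

list : ∀ {n} → Vec ℕ n → List ℕ
list xs = tabulate (lookup xs)

map-vars : ∀ {n k} (θ : Fin k → ℕ) (ι : Fin n → Fin k) → map (val θ) (vars ι) ≡ tabulate (θ ∘ ι)
map-vars θ ι = map-tabulate (var ∘ ι) (val θ)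

private variable
  k m n : ℕ

vars-suffix : ∀ (ys : Vec ℕ k) (xs : Vec ℕ n) →
  map (val (lookup (ys Vec.++ xs))) (vars (k ↑ʳ_)) ≡ list xs
vars-suffix {k} ys xs = trans (map-vars _ (k ↑ʳ_)) (tabulate-cong (lookup-++ʳ ys xs))

module _ (y : ℕ) (ys : Vec ℕ m) (xs : Vec ℕ n) where
  θᶜ : Fin (1 + (m + n)) → ℕ
  θᶜ = lookup (y ∷ ys Vec.++ xs)

  vars-right : map (val θᶜ) (vars (λ i → 1 ↑ʳ (m ↑ʳ i))) ≡ list xs
  vars-right = trans (map-vars θᶜ _) (tabulate-cong (lookup-++ʳ ys xs))

  vars-left : map (val θᶜ) (vars (λ i → 1 ↑ʳ (i ↑ˡ n))) ≡ list ys
  vars-left = trans (map-vars θᶜ _) (tabulate-cong (lookup-++ˡ ys xs))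

  vars-both : map (val θᶜ) (vars (λ i → 1 ↑ʳ (i ↑ˡ n)) ++ vars (λ i → 1 ↑ʳ (m ↑ʳ i))) ≡ list ys ++ list xs
  vars-both = trans (map-++ (val θᶜ) (vars (λ i → 1 ↑ʳ (i ↑ˡ n))) _) (cong₂ _++_ vars-left vars-right)

vars-all : ∀ (xs : Vec ℕ n) → map (val (lookup xs)) (vars id) ≡ list xs
vars-all xs = map-vars (lookup xs) id

-- Computations give derivations

module _ {R : List Rule} where

  ⇓⇒derivable : ∀ {f : Rec n} {xs y} → f [ xs ]⇓ y → ∀ p → rules f p ⊆ R →
    Derivable R (tag p ∷ y ∷ list xs)
  ⇓⇒derivable* : ∀ {gs : Vec (Rec n) m} {xs ys} → Pointwise (λ g y → g [ xs ]⇓ y) gs ys →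
    ∀ p → rules* gs p ⊆ R → Derivable R (tag p ∷ list ys ++ list xs)
  ⇓⇒misses : ∀ {f : Rec (suc n)} {xs y} → (∀ {z} → z < y → ∃ λ v → f [ z ∷ xs ]⇓ suc v) →
    ∀ p → rules (minᵣ f) p ⊆ R → ∀ k → k ≤ y → Derivable R (tag (true ∷ p) ∷ k ∷ list xs)

  ⇓⇒derivable zero⇓ p sub = infer (sub (here refl)) (λ ()) refl refl refl axiom axiom
  ⇓⇒derivable (suc⇓ {x}) p sub = infer (sub (here refl)) (λ _ → x) refl refl refl axiom axiom
  ⇓⇒derivable (proj⇓ {i = i} {xs}) p sub =
    infer (sub (here refl)) (lookup xs) (cong (λ l → tag p ∷ lookup xs i ∷ l) (vars-all xs)) refl refl axiom axiom
  ⇓⇒derivable (comp⇓ {f = f} {xs = xs} {ys} {z} ds d) p sub =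
    infer (sub (here refl)) (θᶜ z ys xs)
      (cong (λ l → tag p ∷ z ∷ l) (vars-right z ys xs))
      (cong (λ l → tag (false ∷ p) ∷ z ∷ l) (vars-left z ys xs))
      (cong (tag (true ∷ p) ∷_) (vars-both z ys xs))
      (⇓⇒derivable d (false ∷ p) (sub ∘ there ∘ ∈-++⁺ˡ))
      (⇓⇒derivable* ds (true ∷ p) (sub ∘ there ∘ ∈-++⁺ʳ (rules f (false ∷ p))))
  ⇓⇒derivable (prec⇓-0 {xs = xs} {y} d) p sub =
    infer (sub (here refl)) (lookup (y ∷ xs))
      (cong (λ l → tag p ∷ y ∷ 0 ∷ l) (vars-suffix (y ∷ []) xs))
      (cong (λ l → tag (false ∷ p) ∷ y ∷ l) (vars-suffix (y ∷ []) xs)) refl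
      (⇓⇒derivable d (false ∷ p) (sub ∘ there ∘ there ∘ ∈-++⁺ˡ)) axiom
  ⇓⇒derivable (prec⇓-s {g = g} {xs = xs} {k} {y} {z} d e) p sub =
    infer (sub (there (here refl))) (lookup (z ∷ k ∷ y ∷ xs))
      (cong (λ l → tag p ∷ z ∷ suc k ∷ l) (vars-suffix (z ∷ k ∷ y ∷ []) xs))
      (cong (λ l → tag p ∷ y ∷ k ∷ l) (vars-suffix (z ∷ k ∷ y ∷ []) xs))
      (cong (λ l → tag (true ∷ p) ∷ z ∷ k ∷ y ∷ l) (vars-suffix (z ∷ k ∷ y ∷ []) xs))
      (⇓⇒derivable d p sub)
      (⇓⇒derivable e (true ∷ p) (sub ∘ there ∘ there ∘ ∈-++⁺ʳ (rules g (false ∷ p))))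
  ⇓⇒derivable (min⇓ {f = f} {xs} {y} d h) p sub =
    infer (sub (here refl)) (lookup (y ∷ xs))
      (cong (λ l → tag p ∷ y ∷ l) (vars-suffix (y ∷ []) xs))
      (cong (λ l → tag (false ∷ p) ∷ 0 ∷ y ∷ l) (vars-suffix (y ∷ []) xs))
      (cong (λ l → tag (true ∷ p) ∷ y ∷ l) (vars-suffix (y ∷ []) xs))
      (⇓⇒derivable d (false ∷ p) (sub ∘ there ∘ there ∘ there))
      (⇓⇒misses h p sub y ≤-refl)

  ⇓⇒misses {xs = xs} h p sub zero k≤y =
    infer (sub (there (here refl))) (lookup xs)
      (cong (λ l → tag (true ∷ p) ∷ 0 ∷ l) (vars-all xs)) refl refl axiom axiom
  ⇓⇒misses {xs = xs} h p sub (suc k) k<y =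
    infer (sub (there (there (here refl)))) (lookup (k ∷ proj₁ (h k<y) ∷ xs))
      (cong (λ l → tag (true ∷ p) ∷ suc k ∷ l) (vars-suffix (_ ∷ _ ∷ []) xs))
      (cong (λ l → tag (true ∷ p) ∷ k ∷ l) (vars-suffix (k ∷ _ ∷ []) xs))
      (cong (λ l → tag (false ∷ p) ∷ suc (proj₁ (h k<y)) ∷ k ∷ l) (vars-suffix (k ∷ _ ∷ []) xs))
      (⇓⇒misses h p sub k (<⇒≤ k<y))
      (⇓⇒derivable (proj₂ (h k<y)) (false ∷ p) (sub ∘ there ∘ there ∘ there))

  ⇓⇒derivable* {xs = xs} [] p sub =
    infer (sub (here refl)) (lookup xs) (cong (tag p ∷_) (vars-all xs)) refl refl axiom axiom
  ⇓⇒derivable* {gs = g ∷ _} {xs} {y ∷ ys} (d ∷ ds) p sub =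
    infer (sub (here refl)) (θᶜ y ys xs)
      (cong (λ l → tag p ∷ y ∷ l) (vars-both y ys xs))
      (cong (λ l → tag (false ∷ p) ∷ y ∷ l) (vars-right y ys xs))
      (cong (tag (true ∷ p) ∷_) (vars-both y ys xs))
      (⇓⇒derivable d (false ∷ p) (sub ∘ there ∘ ∈-++⁺ˡ))
      (⇓⇒derivable* ds (true ∷ p) (sub ∘ there ∘ ∈-++⁺ʳ (rules g (false ∷ p))))

-- Derivations give computations

Holds : Judgment → List ℕ → Set
Holds (eval f)   ws = ∀ y xs → y ∷ list xs ≡ ws → f [ xs ]⇓ y
Holds (evals {m} {n} gs) ws = ∀ (ys : Vec ℕ m) (xs : Vec ℕ n) → list ys ++ list xs ≡ ws → Pointwise (λ g y → g [ xs ]⇓ y) gs ys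
Holds (misses f) ws = ∀ y xs → y ∷ list xs ≡ ws → ∀ {z} → z < y → ∃ λ v → f [ z ∷ xs ]⇓ suc v

module _ (root : Judgment) where

  at : Path → Judgment
  at []      = root
  at (b ∷ p) = child b (at p)

  -- Meaningful for arbitrary lists of numbers: a number that is not a tag imposes nothing, a list
  -- of the wrong length satisfies `Holds` vacuously, and a tag determines its path since the coding
  -- is injective.
  Sound : List ℕ → Set
  Sound []       = ⊤
  Sound (t ∷ ws) = ∀ p → tag p ≡ t → Holds (at p) ws

  Preserves : Rule → Set
  Preserves r = (θ : Fin (arity r) → ℕ) → Sound (map (val θ) (body₁ r)) → Sound (map (val θ) (body₂ r)) →
                Sound (map (val θ) (head r))

  derivable⇒sound : ∀ {R c} → (∀ {r} → r ∈ R → Preserves r) → Derivable R c → Sound c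
  derivable⇒sound pres axiom = tt
  derivable⇒sound pres (infer r∈R θ refl refl refl d e) =
    pres r∈R θ (derivable⇒sound pres d) (derivable⇒sound pres e)

  conclude : ∀ p {j ws} → at p ≡ j → Holds j ws → Sound (tag p ∷ ws)
  conclude p refl h q eq with refl ← code-List-injective bit-injective {q} {p} eq = h

  premise : ∀ p {j ws} → at p ≡ j → Sound (tag p ∷ ws) → Holds j ws
  premise p refl s = s p refl

tabulate-injective : ∀ {f g : Fin n → ℕ} → tabulate f ≡ tabulate g → ∀ i → f i ≡ g i
tabulate-injective eq Fin.zero    = ∷-injectiveˡ eq
tabulate-injective eq (Fin.suc i) = tabulate-injective (∷-injectiveʳ eq) i

++-cancel-length : ∀ {A : Set} (ys ys′ : List A) {xs xs′ : List A} → length ys ≡ length ys′ →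
  ys ++ xs ≡ ys′ ++ xs′ → ys ≡ ys′ × xs ≡ xs′
++-cancel-length []       []         _  eq = refl , eq
++-cancel-length (y ∷ ys) (y′ ∷ ys′) l  eq with ∷-injective eq
... | refl , eq′ with ++-cancel-length ys ys′ (suc-injective l) eq′
...   | refl , eq″ = refl , eq″

valuesOf : (Fin k → ℕ) → (Fin n → Fin k) → Vec ℕ n
valuesOf θ ι = Vec.tabulate (θ ∘ ι)

list-valuesOf : ∀ (θ : Fin k → ℕ) (ι : Fin n → Fin k) → list (valuesOf θ ι) ≡ map (val θ) (vars ι)
list-valuesOf θ ι = trans (tabulate-cong (lookup∘tabulate (θ ∘ ι))) (sym (map-vars θ ι))

module _ {root : Judgment} where

  -- Stated at a position below a fixed root because the premises of a rule carry the tags of other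
  -- positions, so the predicates of the whole tree must be interpreted together.
  rules-sound : ∀ (f : Rec n) {p} → at root p ≡ eval f → ∀ {r} → r ∈ rules f p → Preserves root r
  rules*-sound : ∀ (gs : Vec (Rec n) m) {p} → at root p ≡ evals gs → ∀ {r} → r ∈ rules* gs p → Preserves root r

  rules-sound zeroᵣ {p} e (here refl) θ _ _ = conclude root p e λ { y [] refl → zero⇓ }
  rules-sound sucᵣ {p} e (here refl) θ _ _ = conclude root p e λ { y (x ∷ []) refl → suc⇓ }
  rules-sound (projᵣ i) {p} e (here refl) θ _ _ = conclude root p e λ y xs eq →
    subst (projᵣ i [ xs ]⇓_)
      (trans (tabulate-injective (trans (∷-injectiveʳ eq) (map-vars θ id)) i) (sym (∷-injectiveˡ eq))) proj⇓
  rules-sound {n} (compᵣ {m} f gs) {p} e (here refl) θ s₁ s₂ = conclude root p e case-head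
    where
    ys = valuesOf θ (λ i → 1 ↑ʳ (i ↑ˡ n))
    case-head : ∀ y xs → y ∷ list xs ≡ θ 0F ∷ map (val θ) (vars (λ i → 1 ↑ʳ (m ↑ʳ i))) → compᵣ f gs [ xs ]⇓ y
    case-head y xs eq = comp⇓
      (premise root (true ∷ p) (cong (child true) e) s₂ ys xs
        (trans (cong₂ _++_ (list-valuesOf θ (λ i → 1 ↑ʳ (i ↑ˡ n))) (∷-injectiveʳ eq)) (sym (map-++ (val θ) (vars (λ i → 1 ↑ʳ (i ↑ˡ n))) _))))
      (premise root (false ∷ p) (cong (child false) e) s₁ y ys
        (cong₂ _∷_ (∷-injectiveˡ eq) (list-valuesOf θ (λ i → 1 ↑ʳ (i ↑ˡ n)))))
  rules-sound (compᵣ f gs) {p} e (there r∈) with ∈-++⁻ (rules f (false ∷ p)) r∈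
  ... | inj₁ r∈f  = rules-sound f (cong (child false) e) r∈f
  ... | inj₂ r∈gs = rules*-sound gs (cong (child true) e) r∈gs
  rules-sound (precᵣ g h) {p} e (here refl) θ s₁ s₂ = conclude root p e λ { y (x ∷ xs) → case-zero y x xs }
    where
    case-zero : ∀ y x xs → y ∷ x ∷ list xs ≡ θ 0F ∷ 0 ∷ map (val θ) (vars (1 ↑ʳ_)) → precᵣ g h [ x ∷ xs ]⇓ y
    case-zero y x xs eq with refl ← ∷-injectiveˡ (∷-injectiveʳ eq) =
      prec⇓-0 (premise root (false ∷ p) (cong (child false) e) s₁ y xs
        (cong₂ _∷_ (∷-injectiveˡ eq) (∷-injectiveʳ (∷-injectiveʳ eq))))
  rules-sound (precᵣ g h) {p} e (there (here refl)) θ s₁ s₂ = conclude root p e λ { y (x ∷ xs) → case-suc y x xs }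
    where
    case-suc : ∀ y x xs → y ∷ x ∷ list xs ≡ θ 0F ∷ suc (θ 1F) ∷ map (val θ) (vars (3 ↑ʳ_)) → precᵣ g h [ x ∷ xs ]⇓ y
    case-suc y x xs eq with refl ← ∷-injectiveˡ (∷-injectiveʳ eq) =
      prec⇓-s (premise root p e s₁ (θ 2F) (θ 1F ∷ xs) (cong (λ l → _ ∷ _ ∷ l) eq′))
              (premise root (true ∷ p) (cong (child true) e) s₂ y (θ 1F ∷ θ 2F ∷ xs)
                (cong₂ (λ z l → z ∷ _ ∷ _ ∷ l) (∷-injectiveˡ eq) eq′))
      where eq′ = ∷-injectiveʳ (∷-injectiveʳ eq)
  rules-sound (precᵣ g h) {p} e (there (there r∈)) with ∈-++⁻ (rules g (false ∷ p)) r∈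
  ... | inj₁ r∈g = rules-sound g (cong (child false) e) r∈g
  ... | inj₂ r∈h = rules-sound h (cong (child true) e) r∈h
  rules-sound (minᵣ f) {p} e (here refl) θ s₁ s₂ = conclude root p e λ y xs eq →
    min⇓ (premise root (false ∷ p) (cong (child false) e) s₁ 0 (y ∷ xs) (cong (0 ∷_) eq))
         (premise root (true ∷ p) (cong (child true) e) s₂ y xs eq)
  rules-sound (minᵣ f) {p} e (there (here refl)) θ _ _ = conclude root (true ∷ p) (cong (child true) e) λ { y xs eq z<y → case-zero (∷-injectiveˡ eq) z<y }
    where
    case-zero : ∀ {y z} {P : Set} → y ≡ 0 → z < y → P
    case-zero refl ()
  rules-sound (minᵣ f) {p} e (there (there (here refl))) θ s₁ s₂ = conclude root (true ∷ p) (cong (child true) e) case-suc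
    where
    case-suc : ∀ y xs → y ∷ list xs ≡ suc (θ 0F) ∷ map (val θ) (vars (2 ↑ʳ_)) →
               ∀ {z} → z < y → ∃ λ v → f [ z ∷ xs ]⇓ suc v
    case-suc y xs eq {z} z<y with refl ← ∷-injectiveˡ eq with m≤n⇒m<n∨m≡n (≤-pred z<y)
    ... | inj₁ z<k  = premise root (true ∷ p) (cong (child true) e) s₁ (θ 0F) xs (cong (θ 0F ∷_) (∷-injectiveʳ eq)) z<k
    ... | inj₂ refl = θ 1F , premise root (false ∷ p) (cong (child false) e) s₂ (suc (θ 1F)) (θ 0F ∷ xs) (cong (λ l → _ ∷ _ ∷ l) (∷-injectiveʳ eq))
  rules-sound (minᵣ f) {p} e (there (there (there r∈))) = rules-sound f (cong (child false) e) r∈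

  rules*-sound [] {p} e (here refl) θ _ _ = conclude root p e λ { [] xs eq → [] }
  rules*-sound {n} {suc m} (g ∷ gs) {p} e (here refl) θ s₁ s₂ = conclude root p e λ { (y ∷ ys) → case-cons y ys }
    where
    ι = λ (i : Fin m) → 1 ↑ʳ (i ↑ˡ n)
    case-cons : ∀ y ys xs → y ∷ list ys ++ list xs ≡ θ 0F ∷ map (val θ) (vars ι ++ vars (λ i → 1 ↑ʳ (m ↑ʳ i))) →
                Pointwise (λ g y → g [ xs ]⇓ y) (g ∷ gs) (y ∷ ys)
    case-cons y ys xs eq =
      premise root (false ∷ p) (cong (child false) e) s₁ y xs (cong₂ _∷_ (∷-injectiveˡ eq)
        (proj₂ (++-cancel-length (list ys) (map (val θ) (vars ι))
          (trans (length-tabulate (lookup ys)) (sym (trans (cong length (map-vars θ ι)) (length-tabulate (θ ∘ ι)))))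
          (trans (∷-injectiveʳ eq) (map-++ (val θ) (vars ι) _))))) ∷
      premise root (true ∷ p) (cong (child true) e) s₂ ys xs (∷-injectiveʳ eq)
  rules*-sound (g ∷ gs) {p} e (there r∈) with ∈-++⁻ (rules g (false ∷ p)) r∈
  ... | inj₁ r∈g  = rules-sound g (cong (child false) e) r∈g
  ... | inj₂ r∈gs = rules*-sound gs (cong (child true) e) r∈gs

derivable⇒⇓ : ∀ {f : Rec n} {y xs} → Derivable (rules f []) (tag [] ∷ y ∷ list xs) → f [ xs ]⇓ y
derivable⇒⇓ {f = f} d = derivable⇒sound (eval f) (rules-sound f {[]} refl) d [] refl _ _ refl

-- Disjunctions of conjunctions of linear equations

DNF : Set → Set
DNF V = List (List (Lin V × Lin V))

private variable
  V W : Set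

Solves : (V → ℕ) → Lin V × Lin V → Set
Solves θ (t , u) = val θ t ≡ val θ u

⟦_⟧ : DNF V → (V → ℕ) → Set
⟦ D ⟧ θ = Any (All (Solves θ)) D

infix 4 _≗ᵈ_
infixr 3 _∧ᵈ_

-- Opaque because unfolded formulas make type checking slow.
opaque

  _≗ᵈ_ : Lin V → Lin V → DNF V
  t ≗ᵈ u = ((t , u) ∷ []) ∷ []

  _∧ᵈ_ : DNF V → DNF V → DNF V
  _∧ᵈ_ = cartesianProductWith _++_

  ⋁ : (Fin k → DNF V) → DNF V
  ⋁ D = concat (tabulate D)

  pointwiseᵈ : List (Lin V) → List (Lin V) → DNF V
  pointwiseᵈ []       []       = [] ∷ []
  pointwiseᵈ (t ∷ ts) (u ∷ us) = (t ≗ᵈ u) ∧ᵈ pointwiseᵈ ts us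
  pointwiseᵈ _        _        = []

module _ {θ : V → ℕ} where

  opaque
    unfolding _≗ᵈ_ _∧ᵈ_ ⋁ pointwiseᵈ

    ≗ᵈ⁺ : ∀ {t u} → val θ t ≡ val θ u → ⟦ t ≗ᵈ u ⟧ θ
    ≗ᵈ⁺ e = here (e ∷ [])

    ≗ᵈ⁻ : ∀ {t u} → ⟦ t ≗ᵈ u ⟧ θ → val θ t ≡ val θ u
    ≗ᵈ⁻ (here (e ∷ [])) = e

    ∧ᵈ⁺ : ∀ {D E} → ⟦ D ⟧ θ → ⟦ E ⟧ θ → ⟦ D ∧ᵈ E ⟧ θ
    ∧ᵈ⁺ = Any.cartesianProductWith⁺ _++_ All.++⁺

    ∧ᵈ⁻ : ∀ D E → ⟦ D ∧ᵈ E ⟧ θ → ⟦ D ⟧ θ × ⟦ E ⟧ θ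
    ∧ᵈ⁻ D E = Any.cartesianProductWith⁻ _++_ (All.++⁻ _) D E

    ⋁⁺ : ∀ (D : Fin k → DNF V) i → ⟦ D i ⟧ θ → ⟦ ⋁ D ⟧ θ
    ⋁⁺ D i d = Any.concat⁺ (Any.tabulate⁺ i d)

    ⋁⁻ : ∀ (D : Fin k → DNF V) → ⟦ ⋁ D ⟧ θ → ∃ λ i → ⟦ D i ⟧ θ
    ⋁⁻ D d = Any.tabulate⁻ (Any.concat⁻ (tabulate D) d)

    pointwiseᵈ⁺ : ∀ ts us → map (val θ) ts ≡ map (val θ) us → ⟦ pointwiseᵈ ts us ⟧ θ
    pointwiseᵈ⁺ []       []       e = here []
    pointwiseᵈ⁺ (t ∷ ts) (u ∷ us) e =
      ∧ᵈ⁺ (≗ᵈ⁺ {t} {u} (∷-injectiveˡ e)) (pointwiseᵈ⁺ ts us (∷-injectiveʳ e))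

    pointwiseᵈ⁻ : ∀ ts us → ⟦ pointwiseᵈ ts us ⟧ θ → map (val θ) ts ≡ map (val θ) us
    pointwiseᵈ⁻ []       []       d = refl
    pointwiseᵈ⁻ (t ∷ ts) (u ∷ us) d with ∧ᵈ⁻ (t ≗ᵈ u) (pointwiseᵈ ts us) d
    ... | e , es = cong₂ _∷_ (≗ᵈ⁻ {t} {u} e) (pointwiseᵈ⁻ ts us es)

rename : (V → W) → Lin V → Lin W
rename ρ (lit n) = lit n
rename ρ (var v) = var (ρ v)
rename ρ (t ⊕ u) = rename ρ t ⊕ rename ρ u

val-rename : ∀ (θ : W → ℕ) (ρ : V → W) t → val θ (rename ρ t) ≡ val (θ ∘ ρ) t
val-rename θ ρ (lit n) = refl
val-rename θ ρ (var v) = refl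
val-rename θ ρ (t ⊕ u) = cong₂ _+_ (val-rename θ ρ t) (val-rename θ ρ u)

val-cong : ∀ {θ η : V → ℕ} → θ ≗ η → val θ ≗ val η
val-cong e (lit n) = refl
val-cong e (var v) = e v
val-cong e (t ⊕ u) = cong₂ _+_ (val-cong e t) (val-cong e u)

-- Factors and blocks in lists of numbers

Factor : List ℕ → List ℕ → Set
Factor ms ns = ∃ λ pre → ∃ λ post → ns ≡ pre ++ ms ++ post

opaque
  interleave : ∀ {A : Set} → (Fin k → A) → (Fin k → A) → List A
  interleave {zero}  f g = []
  interleave {suc k} f g = f zero ∷ g zero ∷ interleave (f ∘ suc) (g ∘ suc)

  map-interleave : ∀ {A B : Set} (h : A → B) (f g : Fin k → A) →
    map h (interleave f g) ≡ interleave (h ∘ f) (h ∘ g)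
  map-interleave {zero}  h f g = refl
  map-interleave {suc k} h f g = cong (λ l → _ ∷ _ ∷ l) (map-interleave h (f ∘ suc) (g ∘ suc))

  interleave-cong : ∀ {A : Set} {f f′ g g′ : Fin k → A} → f ≗ f′ → g ≗ g′ → interleave f g ≡ interleave f′ g′
  interleave-cong {zero}  p q = refl
  interleave-cong {suc k} p q =
    cong₂ _∷_ (p zero) (cong₂ _∷_ (q zero) (interleave-cong (p ∘ suc) (q ∘ suc)))

  interleave-++-injective : ∀ {A : Set} {f g f′ g′ : Fin k → A} {xs ys} →
    interleave f g ++ xs ≡ interleave f′ g′ ++ ys → f ≗ f′ × g ≗ g′ × xs ≡ ys
  interleave-++-injective {zero}  e = (λ ()) , (λ ()) , e
  interleave-++-injective {suc k} {f = f} {g} {f′} {g′} e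
    with interleave-++-injective {f = f ∘ suc} {g ∘ suc} {f′ ∘ suc} {g′ ∘ suc} (∷-injectiveʳ (∷-injectiveʳ e))
  ... | p , q , r = (λ { zero → ∷-injectiveˡ e ; (suc i) → p i })
                  , (λ { zero → ∷-injectiveˡ (∷-injectiveʳ e) ; (suc i) → q i }) , r

  length-interleave : ∀ {A : Set} (f g : Fin k → A) → length (interleave f g) ≡ k + k
  length-interleave {zero}  f g = refl
  length-interleave {suc k} f g =
    cong suc (trans (cong suc (length-interleave (f ∘ suc) (g ∘ suc))) (sym (+-suc k k)))

  interleaving : ∀ {A : Set} k (xs : List A) → k + k ≤ length xs →
    ∃ λ (f : Fin k → A) → ∃ λ g → ∃ λ ys → xs ≡ interleave f g ++ ys
  interleaving zero    xs           l = (λ ()) , (λ ()) , xs , refl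
  interleaving (suc k) (x ∷ [])     l with () ← ≤-trans (≤-reflexive (sym (+-suc k k))) (≤-pred l)
  interleaving (suc k) (x ∷ y ∷ xs) l
    with interleaving k xs (≤-pred (≤-trans (≤-reflexive (sym (+-suc k k))) (≤-pred l)))
  ... | f , g , ys , refl = x ∷ᶠ f , y ∷ᶠ g , ys , refl

block : ∀ {A : Set} → A → A → A → (Fin k → A) → (Fin k → A) → List A
block a b c f g = a ∷ b ∷ c ∷ interleave f g

block-cong : ∀ {A : Set} {a a′ b b′ c c′ : A} {f f′ g g′ : Fin k → A} →
  a ≡ a′ → b ≡ b′ → c ≡ c′ → f ≗ f′ → g ≗ g′ → block a b c f g ≡ block a′ b′ c′ f′ g′
block-cong refl refl refl p q = cong (λ l → _ ∷ _ ∷ _ ∷ l) (interleave-cong p q)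

map-block : ∀ {A B : Set} (h : A → B) a b c (f g : Fin k → A) →
  map h (block a b c f g) ≡ block (h a) (h b) (h c) (h ∘ f) (h ∘ g)
map-block h a b c f g = cong (λ l → h a ∷ h b ∷ h c ∷ l) (map-interleave h f g)

opaque
  unfolding interleave

  -- An entry carries a 1 after every field, so two adjacent zeros start a block.
  no-zeros-inside : ∀ (f : Fin k → ℕ) {rest pre ms} → interleave f (λ _ → 1) ++ rest ≡ pre ++ 0 ∷ 0 ∷ ms →
    ∃ λ pre′ → rest ≡ pre′ ++ 0 ∷ 0 ∷ ms
  no-zeros-inside {zero}  f {pre = pre} e = pre , e
  no-zeros-inside {suc k} f {pre = []} e with () ← ∷-injectiveˡ (∷-injectiveʳ e)
  no-zeros-inside {suc k} f {pre = _ ∷ []} e with () ← ∷-injectiveˡ (∷-injectiveʳ e)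
  no-zeros-inside {suc k} f {pre = _ ∷ _ ∷ pre} e = no-zeros-inside (f ∘ suc) {pre = pre} (∷-injectiveʳ (∷-injectiveʳ e))

++-compare : ∀ {A : Set} (xs xs′ : List A) {ys ys′} → xs ++ ys ≡ xs′ ++ ys′ →
  (∃ λ zs → ys ≡ zs ++ ys′) ⊎ (∃ λ zs → ys′ ≡ zs ++ ys)
++-compare []       xs′        e = inj₁ (xs′ , e)
++-compare (x ∷ xs) []         e = inj₂ (x ∷ xs , sym e)
++-compare (x ∷ xs) (x′ ∷ xs′) e = ++-compare xs xs′ (∷-injectiveʳ e)

extendBy0 : ∀ {m n} → (Fin m → ℕ) → Fin n → ℕ
extendBy0 {zero}  θ i       = 0
extendBy0 {suc m} θ zero    = θ zero
extendBy0 {suc m} θ (suc i) = extendBy0 (θ ∘ suc) i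

extendBy0-inject≤ : ∀ {m n} (θ : Fin m → ℕ) (m≤n : m ≤ n) j → extendBy0 θ (inject≤ j m≤n) ≡ θ j
extendBy0-inject≤ {n = suc n} θ m≤n zero    = refl
extendBy0-inject≤ {n = suc n} θ m≤n (suc j) = extendBy0-inject≤ (θ ∘ suc) (≤-pred m≤n) j

arity≤sum : ∀ (R : List Rule) i → arity (List.lookup R i) ≤ sum (map arity R)
arity≤sum (r ∷ R) zero    = m≤m+n (arity r) _
arity≤sum (r ∷ R) (suc i) = ≤-trans (arity≤sum R i) (m≤n+m _ (arity r))

-- Derivations as lists of numbers

module Certificates (R : List Rule) {g : ℕ} (goal : List (Lin (Fin g))) where

  -- Rule 0 belongs to the dummy record, which serves as target for premises [] and closes the list;
  -- rule 1 marks the root record.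
  program : List Rule
  program = rule 0 [] [] [] ∷ rule g [] goal [] ∷ R

  -- The sum of the arities is a convenient common bound for them. Records of one fixed length can
  -- be matched by finitely many templates, whatever rule they use.
  vars# size : ℕ
  vars# = sum (map arity program)
  size  = 6 + vars#

  Index : Set
  Index = Fin (length program)

  ruleAt : Index → Rule
  ruleAt = List.lookup program

  field-of : ∀ r → Fin (arity (ruleAt r)) → Fin size
  field-of r j = 6 ↑ʳ inject≤ j (arity≤sum program r)

  -- The fields of a record: 0 index, 1 rule, 2 and 4 indices of the records proving the premises,
  -- 3 and 5 slacks witnessing that these indices are smaller, from 6 on the values of the rule's variables.
  Entry : Set
  Entry = Fin size → ℕ

  -- The marker 0 0 1 and the separators 1 leave two adjacent zeros only at the start of a record.
  -- Without the 1 in the marker, an index 0 would create a second such place.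
  encode : Entry → List ℕ
  encode e = block 0 0 1 e (λ _ → 1)

  dummy : Entry
  dummy _ = 0

  -- Seven families of number variables: 0 a record, 1, 2 and 6 the block after it (its fields, the
  -- numbers separating them, its first three numbers), 3 a record, 4 and 5 the records it points to.
  Var : Set
  Var = Fin 7 × Fin size

  instanceᵛ : Fin 7 → (r : Index) → List (Lin (Fin (arity (ruleAt r)))) → List (Lin Var)
  instanceᵛ f r = map (rename (λ j → f , field-of r j))

  instanceOf : Entry → (r : Index) → List (Lin (Fin (arity (ruleAt r)))) → List ℕ
  instanceOf e r = map (val (e ∘ field-of r))

  template : (Fin size → Lin Var) → List (Lin Var)
  template f = block (lit 0) (lit 0) (lit 1) f (λ _ → lit 1)

  -- The index of a record pointed to is the pointer itself: one variable, occurring in two windows.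
  redirect : Fin size → Fin 7 → Fin size → Lin Var
  redirect p f zero    = var (3F , p)
  redirect p f (suc i) = var (f , suc i)

  -- The second block is entirely free, marker and separators included. It thus matches whatever
  -- follows a record, and it is left to `nextᵈ` to force it to be a record again.
  template₀ : List (Lin Var)
  template₀ = template (λ i → var (0F , i)) ++
    block (var (6F , 0F)) (var (6F , 1F)) (var (6F , 2F)) (λ i → var (1F , i)) (λ i → var (2F , i))

  templates : List (List (Lin Var))
  templates =
    template₀ ∷
    template (λ i → var (3F , i)) ∷
    template (redirect 2F 4F) ∷
    template (redirect 4F 5F) ∷ []

  isOneᵈ : Fin size → Lin Var × Lin Var
  isOneᵈ i = var (2F , i) , lit 1

  -- Indices decrease by one along the list, down to 0.
  nextᵈ withinᵈ checkᵈ condition : DNF Var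
  nextᵈ = (var (0F , 0F) ≗ᵈ lit 0) ++
    (( (var (6F , 0F) , lit 0) ∷ (var (6F , 1F) , lit 0) ∷ (var (6F , 2F) , lit 1)
     ∷ (var (0F , 0F) , lit 1 ⊕ var (1F , 0F))
     ∷ tabulate isOneᵈ) ∷ [])
  withinᵈ = (var (0F , 1F) ≗ᵈ lit 0) ++
    (((var (0F , 0F) , lit 1 ⊕ (var (0F , 2F) ⊕ var (0F , 3F)))
     ∷ (var (0F , 0F) , lit 1 ⊕ (var (0F , 4F) ⊕ var (0F , 5F))) ∷ []) ∷ [])

  concludesByᵈ : Fin 7 → List (Lin Var) → Index → DNF Var
  concludesByᵈ f ts r = (var (f , 1F) ≗ᵈ lit (toℕ r)) ∧ᵈ pointwiseᵈ (instanceᵛ f r (head (ruleAt r))) ts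

  concludesᵈ : Fin 7 → List (Lin Var) → DNF Var
  concludesᵈ f ts = ⋁ (concludesByᵈ f ts)

  checkByᵈ : Index → DNF Var
  checkByᵈ r = (var (3F , 1F) ≗ᵈ lit (toℕ r)) ∧ᵈ
    concludesᵈ 4F (instanceᵛ 3F r (body₁ (ruleAt r))) ∧ᵈ concludesᵈ 5F (instanceᵛ 3F r (body₂ (ruleAt r)))

  checkᵈ = ⋁ checkByᵈ

  condition = nextᵈ ∧ᵈ withinᵈ ∧ᵈ checkᵈ

  Locally : List ℕ → Set
  Locally ns = ∀ θ → All (λ t → Factor (map (val θ) t) ns) templates → ⟦ condition ⟧ θ

  blockLength : ℕ
  blockLength = 3 + (size + size)

  opaque
    -- Records start with 0, so none starts among these ones. One that starts earlier may still run
    -- into them by less than a block; the double length ensures that a whole block follows it even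
    -- then.
    padding : List ℕ
    padding = replicate (blockLength + blockLength) 1

    padding-ones : All (1 ≡_) padding
    padding-ones = All.replicate⁺ (blockLength + blockLength) refl

    length-padding : length padding ≡ blockLength + blockLength
    length-padding = length-replicate (blockLength + blockLength)

  Concludes : Entry → List ℕ → Set
  Concludes e ws = ∃ λ r → e 1F ≡ toℕ r × instanceOf e r (head (ruleAt r)) ≡ ws

  Supported : Entry → Entry → Entry → Index → Set
  Supported w w₁ w₂ r = Concludes w₁ (instanceOf w r (body₁ (ruleAt r))) × Concludes w₂ (instanceOf w r (body₂ (ruleAt r)))

  module _ (θ : Var → ℕ) where
    private
      e : Fin 7 → Entry
      e f i = θ (f , i)

    instance-val : ∀ f r ts → map (val θ) (instanceᵛ f r ts) ≡ instanceOf (e f) r ts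
    instance-val f r ts = trans (sym (map-∘ ts)) (map-cong (val-rename θ _) ts)

    Next Within Check : Set
    Next = e 0F 0F ≡ 0 ⊎
      (e 6F 0F ≡ 0 × e 6F 1F ≡ 0 × e 6F 2F ≡ 1 × e 0F 0F ≡ suc (e 1F 0F) × (∀ i → e 2F i ≡ 1))
    Within = e 0F 1F ≡ 0 ⊎
      (e 0F 0F ≡ suc (e 0F 2F + e 0F 3F) × e 0F 0F ≡ suc (e 0F 4F + e 0F 5F))
    Check = ∃ λ r → e 3F 1F ≡ toℕ r ×
      Concludes (e 4F) (instanceOf (e 3F) r (body₁ (ruleAt r))) ×
      Concludes (e 5F) (instanceOf (e 3F) r (body₂ (ruleAt r)))

    concludes⁺ : ∀ f ts → Concludes (e f) (map (val θ) ts) → ⟦ concludesᵈ f ts ⟧ θ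
    concludes⁺ f ts (r , p , q) = ⋁⁺ (concludesByᵈ f ts) r (∧ᵈ⁺ (≗ᵈ⁺ {t = var (f , 1F)} {lit (toℕ r)} p)
      (pointwiseᵈ⁺ _ ts (trans (instance-val f r _) q)))

    concludes⁻ : ∀ f ts → ⟦ concludesᵈ f ts ⟧ θ → Concludes (e f) (map (val θ) ts)
    concludes⁻ f ts d with ⋁⁻ (concludesByᵈ f ts) d
    ... | r , d′ with ∧ᵈ⁻ (var (f , 1F) ≗ᵈ lit (toℕ r)) _ d′
    ... | p , q = r , ≗ᵈ⁻ {t = var (f , 1F)} {lit (toℕ r)} p , trans (sym (instance-val f r _)) (pointwiseᵈ⁻ _ ts q)

    check⁺ : Check → ⟦ checkᵈ ⟧ θ
    check⁺ (r , p , c₁ , c₂) = ⋁⁺ checkByᵈ r (∧ᵈ⁺ (≗ᵈ⁺ {t = var (3F , 1F)} {lit (toℕ r)} p) (∧ᵈ⁺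
      (concludes⁺ 4F _ (subst (Concludes (e 4F)) (sym (instance-val 3F r _)) c₁))
      (concludes⁺ 5F _ (subst (Concludes (e 5F)) (sym (instance-val 3F r _)) c₂))))

    check⁻ : ⟦ checkᵈ ⟧ θ → Check
    check⁻ d with ⋁⁻ checkByᵈ d
    ... | r , d′ with ∧ᵈ⁻ (var (3F , 1F) ≗ᵈ lit (toℕ r)) _ d′
    ... | p , d″ with ∧ᵈ⁻ (concludesᵈ 4F (instanceᵛ 3F r (body₁ (ruleAt r)))) _ d″
    ... | c₁ , c₂ = r , ≗ᵈ⁻ {t = var (3F , 1F)} {lit (toℕ r)} p
                  , subst (Concludes (e 4F)) (instance-val 3F r _) (concludes⁻ 4F _ c₁)
                  , subst (Concludes (e 5F)) (instance-val 3F r _) (concludes⁻ 5F _ c₂)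

    condition⁺ : Next → Within → Check → ⟦ condition ⟧ θ
    condition⁺ n w c = ∧ᵈ⁺ (next⁺ n) (∧ᵈ⁺ (within⁺ w) (check⁺ c))
      where
      next⁺ : Next → ⟦ nextᵈ ⟧ θ
      next⁺ (inj₁ p)                   = Any.++⁺ˡ (≗ᵈ⁺ {t = var (0F , 0F)} {lit 0} p)
      next⁺ (inj₂ (p , q , r , s , t)) = Any.++⁺ʳ (var (0F , 0F) ≗ᵈ lit 0) (here (p ∷ q ∷ r ∷ s ∷ All.tabulate⁺ {f = isOneᵈ} t))
      within⁺ : Within → ⟦ withinᵈ ⟧ θ
      within⁺ (inj₁ p)       = Any.++⁺ˡ (≗ᵈ⁺ {t = var (0F , 1F)} {lit 0} p)
      within⁺ (inj₂ (p , q)) = Any.++⁺ʳ (var (0F , 1F) ≗ᵈ lit 0) (here (p ∷ q ∷ []))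

    condition⁻ : ⟦ condition ⟧ θ → Next × Within × Check
    condition⁻ d with ∧ᵈ⁻ nextᵈ (withinᵈ ∧ᵈ checkᵈ) d
    ... | n , d′ with ∧ᵈ⁻ withinᵈ checkᵈ d′
    ... | w , c = next⁻ n , within⁻ w , check⁻ c
      where
      next⁻ : ⟦ nextᵈ ⟧ θ → Next
      next⁻ d with Any.++⁻ (var (0F , 0F) ≗ᵈ lit 0) d
      ... | inj₁ p                            = inj₁ (≗ᵈ⁻ {t = var (0F , 0F)} {lit 0} p)
      ... | inj₂ (here (p ∷ q ∷ r ∷ s ∷ t)) = inj₂ (p , q , r , s , All.tabulate⁻ {f = isOneᵈ} t)
      within⁻ : ⟦ withinᵈ ⟧ θ → Within
      within⁻ d with Any.++⁻ (var (0F , 1F) ≗ᵈ lit 0) d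
      ... | inj₁ p                   = inj₁ (≗ᵈ⁻ {t = var (0F , 1F)} {lit 0} p)
      ... | inj₂ (here (p ∷ q ∷ [])) = inj₂ (p , q)

  assign : (w n m w₁ w₂ w₃ u : Entry) → Var → ℕ
  assign w n m w₁ w₂ w₃ u (0F , i) = w i
  assign w n m w₁ w₂ w₃ u (1F , i) = n i
  assign w n m w₁ w₂ w₃ u (2F , i) = m i
  assign w n m w₁ w₂ w₃ u (3F , i) = w₁ i
  assign w n m w₁ w₂ w₃ u (4F , i) = w₂ i
  assign w n m w₁ w₂ w₃ u (5F , i) = w₃ i
  assign w n m w₁ w₂ w₃ u (6F , i) = u i

  successor : (u n m : Entry) → List ℕ
  successor u n m = block (u 0F) (u 1F) (u 2F) n m

  Occurs : Entry → List ℕ → Set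
  Occurs e = Factor (encode e)

  template-val : ∀ θ f → map (val θ) (template f) ≡ encode (val θ ∘ f)
  template-val θ f = map-block (val θ) (lit 0) (lit 0) (lit 1) f (λ _ → lit 1)

  template₀-val : ∀ θ → map (val θ) template₀
    ≡ encode (λ i → θ (0F , i)) ++ successor (λ i → θ (6F , i)) (λ i → θ (1F , i)) (λ i → θ (2F , i))
  template₀-val θ = trans (map-++ (val θ) (template (λ i → var (0F , i))) _)
    (cong₂ _++_ (template-val θ (λ i → var (0F , i)))
                (map-block (val θ) (var (6F , 0F)) (var (6F , 1F)) (var (6F , 2F)) (λ i → var (1F , i)) (λ i → var (2F , i))))

  redirect-val : ∀ θ p f → θ (f , 0F) ≡ θ (3F , p) → (λ i → θ (f , i)) ≗ val θ ∘ redirect p f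
  redirect-val θ p f e zero    = e
  redirect-val θ p f e (suc i) = refl

  encode-cong : ∀ {e e′} → e ≗ e′ → encode e ≡ encode e′
  encode-cong p = block-cong refl refl refl p λ _ → refl

  length-encode : ∀ e → length (encode e) ≡ blockLength
  length-encode e = cong (3 +_) (length-interleave e _)

  splitSuccessor : ∀ z → blockLength ≤ length z → ∃ λ u → ∃ λ n → ∃ λ m → ∃ λ z′ → z ≡ successor u n m ++ z′
  splitSuccessor (a ∷ b ∷ c ∷ z) (s≤s (s≤s (s≤s l))) with interleaving size z l
  ... | n , m , z′ , refl = (a ∷ᶠ b ∷ᶠ c ∷ᶠ λ _ → 0) , n , m , z′ , refl

  -- The dummy plays every record at once, because its pointers 0 equal its own index, and the
  -- padding plays the block after it. `Clause.sound` needs such an instance of the hypotheses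
  -- before it can confine `x` to the letters a and b.
  dummy-windows : ∃ λ θ → All (λ t → Factor (map (val θ) t) (encode dummy ++ padding)) templates
  dummy-windows =
    let u , n , m , z , p = splitSuccessor padding (≤-trans (m≤m+n _ _) (≤-reflexive (sym length-padding)))
        θ = assign dummy n m dummy dummy dummy u
    in θ ,
      ( ([] , z , trans (cong (encode dummy ++_) p)
          (trans (sym (++-assoc (encode dummy) (successor u n m) z)) (cong (_++ z) (sym (template₀-val θ)))))
      ∷ ([] , padding , cong (_++ padding) (sym (template-val θ _)))
      ∷ ([] , padding , cong (_++ padding) (trans (encode-cong (redirect-val θ 2F 4F refl)) (sym (template-val θ _))))
      ∷ ([] , padding , cong (_++ padding) (trans (encode-cong (redirect-val θ 4F 5F refl)) (sym (template-val θ _))))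
      ∷ [])

  -- Local correctness implies derivability

  module Soundness {ns pre : List ℕ} (local : Locally ns) (ends : ns ≡ pre ++ encode dummy ++ padding) where

    dummy-occurs : Occurs dummy ns
    dummy-occurs = pre , padding , ends

    locally : ∀ w u n m w₁ w₂ w₃ → Factor (encode w ++ successor u n m) ns →
      Occurs w₁ ns → Occurs w₂ ns → Occurs w₃ ns → w₂ 0F ≡ w₁ 2F → w₃ 0F ≡ w₁ 4F →
      let θ = assign w n m w₁ w₂ w₃ u in Next θ × Within θ × Check θ
    locally w u n m w₁ w₂ w₃ F₀ F₁ F₂ F₃ p q = condition⁻ θ (local θ
      ( subst (λ l → Factor l ns) (sym (template₀-val θ)) F₀
      ∷ subst (λ l → Factor l ns) (sym (template-val θ _)) F₁
      ∷ subst (λ l → Factor l ns) (trans (encode-cong (redirect-val θ 2F 4F p)) (sym (template-val θ _))) F₂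
      ∷ subst (λ l → Factor l ns) (trans (encode-cong (redirect-val θ 4F 5F q)) (sym (template-val θ _))) F₃
      ∷ []))
      where θ = assign w n m w₁ w₂ w₃ u

    followed : ∀ w → Occurs w ns → ∃ λ u → ∃ λ n → ∃ λ m → Factor (encode w ++ successor u n m) ns
    followed w (y , z , eq) with ++-compare (pre ++ encode dummy) y
      (trans (++-assoc pre (encode dummy) padding) (trans (sym ends) eq))
    ... | inj₁ (c , eq′) with () ← All.head (All.++⁻ʳ c (subst (All (1 ≡_)) eq′ padding-ones))
    ... | inj₂ (c , eq′) = let u , n , m , z′ , p = splitSuccessor z enough in
      u , n , m , y , z′ , trans eq (cong (y ++_)
        (trans (cong (encode w ++_) p) (sym (++-assoc (encode w) (successor u n m) z′))))
      where
      enough : blockLength ≤ length z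
      enough = +-cancelˡ-≤ blockLength _ _ (begin
        blockLength + blockLength            ≡⟨ sym length-padding ⟩
        length padding                       ≤⟨ m≤n+m _ (length c) ⟩
        length c + length padding            ≡⟨ sym (length-++ c) ⟩
        length (c ++ padding)                ≡⟨ cong length (sym eq′) ⟩
        length (encode w ++ z)               ≡⟨ length-++ (encode w) ⟩
        length (encode w) + length z         ≡⟨ cong (_+ length z) (length-encode w) ⟩
        blockLength + length z               ∎)
        where open ≤-Reasoning

    -- This undoes the merging of the clauses: the dummy occupies the families 3, 4 and 5, which
    -- belong to the check, and leaves a statement about `w` alone.
    next : ∀ w → Occurs w ns → w 0F ≡ 0 ⊎ ∃ λ w′ → Occurs w′ ns × w 0F ≡ suc (w′ 0F)
    next w o with followed w o
    ... | u , n , m , F@(y , z , eq) with proj₁ (locally w u n m dummy dummy dummy F dummy-occurs dummy-occurs dummy-occurs refl refl)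
    ... | inj₁ p = inj₁ p
    ... | inj₂ (p , q , r , s , t) = inj₂ (n , (y ++ encode w , z , eq′) , s)
      where
      same : successor u n m ≡ encode n
      same = block-cong {f = n} p q r (λ _ → refl) t
      eq′ : ns ≡ (y ++ encode w) ++ encode n ++ z
      eq′ = begin
        ns                                         ≡⟨ eq ⟩
        y ++ (encode w ++ successor u n m) ++ z    ≡⟨ cong (y ++_) (++-assoc (encode w) _ z) ⟩
        y ++ encode w ++ successor u n m ++ z      ≡⟨ cong (λ l → y ++ encode w ++ l ++ z) same ⟩
        y ++ encode w ++ encode n ++ z             ≡⟨ sym (++-assoc y (encode w) _) ⟩
        (y ++ encode w) ++ encode n ++ z           ∎
        where open ≡-Reasoning

    -- The source of the records pointed to, whose existence no universal condition can assert.
    -- Several records might share an index; this is harmless because `check` holds for every choice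
    -- of them.
    lower : ∀ k w → Occurs w ns → w 0F ≡ k → ∀ {j} → j ≤ k → ∃ λ w′ → Occurs w′ ns × w′ 0F ≡ j
    lower k w o p j≤k with m≤n⇒m<n∨m≡n j≤k
    ... | inj₂ refl = w , o , p
    lower (suc k) w o p j≤k | inj₁ j<k with next w o
    ... | inj₁ q            with () ← trans (sym p) q
    ... | inj₂ (w′ , o′ , q) = lower k w′ o′ (suc-injective (trans (sym q) p)) (≤-pred j<k)

    within : ∀ w → Occurs w ns → w 1F ≡ 0 ⊎
      (w 0F ≡ suc (w 2F + w 3F) × w 0F ≡ suc (w 4F + w 5F))
    within w o = let u , n , m , F = followed w o in
      proj₁ (proj₂ (locally w u n m dummy dummy dummy F dummy-occurs dummy-occurs dummy-occurs refl refl))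

    check : ∀ w w₁ w₂ → Occurs w ns → Occurs w₁ ns → Occurs w₂ ns → w₁ 0F ≡ w 2F → w₂ 0F ≡ w 4F →
      ∃ λ r → w 1F ≡ toℕ r × Supported w w₁ w₂ r
    check w w₁ w₂ o o₁ o₂ e₁ e₂ = let u , n , m , F = followed w o in
      proj₂ (proj₂ (locally w u n m w w₁ w₂ F o o₁ o₂ e₁ e₂))

    Justified : Entry → Index → Set
    Justified w r = Derivable R (instanceOf w r (body₁ (ruleAt r))) × Derivable R (instanceOf w r (body₂ (ruleAt r)))

    Head : Entry → Index → Set
    Head w r = Derivable R (instanceOf w r (head (ruleAt r)))

    concluded : ∀ {e ws} → (∀ r → e 1F ≡ toℕ r → Head e r) → Concludes e ws → Derivable R ws
    concluded h (r , p , q) = subst (Derivable R) q (h r p)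

    -- Induction on a bound for the index, as pointers go to smaller indices. Rule 0 is exempt from
    -- this decrease by `withinᵈ`, hence the `suc`; it and the root rule have head `[]`, which is
    -- derivable outright.
    bodies : ∀ k w → Occurs w ns → w 0F < k → ∀ r → w 1F ≡ suc (toℕ r) → Justified w (suc r)
    heads : ∀ k w → Occurs w ns → w 0F < k → ∀ r → w 1F ≡ toℕ r → Head w r

    heads k w o l zero          e = axiom
    heads k w o l (suc zero)    e = axiom
    heads k w o l (suc (suc r)) e = let d₁ , d₂ = bodies k w o l (suc r) e in
      infer (∈-lookup r) (w ∘ field-of (suc (suc r))) refl refl refl d₁ d₂

    bodies (suc k) w o (s≤s l) r e = by-within (within w o)
      where
      below : ∀ {a b c s} → a ≡ suc (c + s) → b ≡ c → a ≤ k → b < k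
      below refl refl l = ≤-trans (s≤s (m≤m+n _ _)) l

      pointer≤ : ∀ {a b s} → a ≡ suc (b + s) → b ≤ a
      pointer≤ refl = m≤n⇒m≤1+n (m≤m+n _ _)

      by-within : w 1F ≡ 0 ⊎ (w 0F ≡ suc (w 2F + w 3F) × w 0F ≡ suc (w 4F + w 5F)) → Justified w (suc r)
      by-within (inj₁ p) with () ← trans (sym e) p
      by-within (inj₂ (p , q)) =
        let w₁ , o₁ , e₁ = lower _ w o refl (pointer≤ p)
            w₂ , o₂ , e₂ = lower _ w o refl (pointer≤ q)
            r′ , e′ , s = check w w₁ w₂ o o₁ o₂ e₁ e₂
            c₁ , c₂ = subst (Supported w w₁ w₂) (toℕ-injective {i = r′} {suc r} (trans (sym e′) e)) s
        in concluded {w₁} (heads k w₁ o₁ (below p e₁ l)) c₁ , concluded {w₂} (heads k w₂ o₂ (below q e₂ l)) c₂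

    derivable-goal : ∀ q {rest} → ns ≡ encode q ++ rest → q 1F ≡ 1 →
      Derivable R (instanceOf q (suc zero) goal)
    derivable-goal q {rest} eq e = proj₁ (bodies _ q ([] , rest , eq) ≤-refl zero e)

  -- Derivations give locally correct lists

  flat : List Entry → List ℕ
  flat []       = padding
  flat (e ∷ es) = encode e ++ flat es

  align : ∀ es {pre ms} → flat es ≡ pre ++ 0 ∷ 0 ∷ ms →
    ∃ λ es₁ → ∃ λ e → ∃ λ es₂ → es ≡ es₁ ++ e ∷ es₂ × ms ≡ 1 ∷ interleave e (λ _ → 1) ++ flat es₂
  align [] {pre} eq with () ← All.head (All.++⁻ʳ pre (subst (All (1 ≡_)) eq padding-ones))
  align (e ∷ es) {[]}         eq = [] , e , es , refl , sym (∷-injectiveʳ (∷-injectiveʳ eq))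
  align (e ∷ es) {_ ∷ []}     eq with () ← ∷-injectiveˡ (∷-injectiveʳ (∷-injectiveʳ eq))
  align (e ∷ es) {_ ∷ _ ∷ []} eq with () ← ∷-injectiveˡ (∷-injectiveʳ (∷-injectiveʳ eq))
  align (e ∷ es) {_ ∷ _ ∷ _ ∷ pre} eq =
    let pre′ , eq′ = no-zeros-inside e {pre = pre} (∷-injectiveʳ (∷-injectiveʳ (∷-injectiveʳ eq)))
        es₁ , e′ , es₂ , p , q = align es {pre′} eq′
    in e ∷ es₁ , e′ , es₂ , cong (e ∷_) p , q

  align-entry : ∀ es w {pre rest} → flat es ≡ pre ++ encode w ++ rest →
    ∃ λ es₁ → ∃ λ e → ∃ λ es₂ → es ≡ es₁ ++ e ∷ es₂ × w ≗ e × rest ≡ flat es₂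
  align-entry es w {pre} {rest} eq =
    let es₁ , e , es₂ , p , q = align es {pre} eq
        w≗e , _ , r = interleave-++-injective {f = w} {λ _ → 1} {e} {λ _ → 1} {rest} (∷-injectiveʳ q)
    in es₁ , e , es₂ , p , w≗e , r

  Links : List Entry → Entry → Entry → Entry → Index → Set
  Links es e e₁ e₂ r = e 1F ≡ toℕ r × e₁ ∈ es × e₂ ∈ es × e₁ 0F ≡ e 2F × e₂ 0F ≡ e 4F × Supported e e₁ e₂ r

  Earlier : Entry → Set
  Earlier e = e 1F ≡ 0 ⊎ (e 0F ≡ suc (e 2F + e 3F) × e 0F ≡ suc (e 4F + e 5F))

  -- Built from the dummy backwards: each new record is put in front of those it may point to, and
  -- its index counts the records behind it.
  data Table : List Entry → Set where
    start : Table (dummy ∷ [])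
    step  : ∀ {es e e₁ e₂ r} → Table es → e 0F ≡ length es → Earlier e → Links es e e₁ e₂ r → Table (e ∷ es)

  dummy-links : Links (dummy ∷ []) dummy dummy dummy zero
  dummy-links = refl , here refl , here refl , refl , refl , (zero , refl , refl) , (zero , refl , refl)

  first-id : ∀ {e es} → Table (e ∷ es) → e 0F ≡ length es
  first-id start         = refl
  first-id (step _ p _ _) = p

  id-bound : ∀ {es e} → Table es → e ∈ es → e 0F < length es
  id-bound t@start          (here refl) = s≤s (≤-reflexive (first-id t))
  id-bound t@(step _ p _ _) (here refl) = s≤s (≤-reflexive p)
  id-bound (step t _ _ _)   (there e∈)  = m≤n⇒m≤1+n (id-bound t e∈)

  -- The check ranges over every record bearing the index pointed to. Uniqueness identifies such a
  -- record with the one for which support is known.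
  id-injective : ∀ {es e e′} → Table es → e ∈ es → e′ ∈ es → e 0F ≡ e′ 0F → e ≡ e′
  id-injective t (here refl) (here refl) p = refl
  id-injective (step t q _ _) (here refl) (there e′∈) p =
    contradiction (trans (sym p) q) (<⇒≢ (id-bound t e′∈))
  id-injective (step t q _ _) (there e∈) (here refl) p =
    contradiction (trans p q) (<⇒≢ (id-bound t e∈))
  id-injective (step t _ _ _) (there e∈) (there e′∈) p = id-injective t e∈ e′∈ p

  links-weaken : ∀ {es e′} e {e₁ e₂ r} → Links es e e₁ e₂ r → Links (e′ ∷ es) e e₁ e₂ r
  links-weaken e (p , q , r , s) = p , there q , there r , s

  earlier : ∀ {es e} → Table es → e ∈ es → Earlier e
  earlier start          (here refl) = inj₁ refl
  earlier (step _ _ p _) (here refl) = p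
  earlier (step t _ _ _) (there e∈)  = earlier t e∈

  links : ∀ {es e} → Table es → e ∈ es → ∃ λ e₁ → ∃ λ e₂ → ∃ λ r → Links es e e₁ e₂ r
  links start          (here refl) = dummy , dummy , zero , dummy-links
  links (step {e = e} _ _ _ l) (here refl) = _ , _ , _ , links-weaken e l
  links {e = e} (step t _ _ _) (there e∈)  = let e₁ , e₂ , r , l = links t e∈ in e₁ , e₂ , r , links-weaken e l

  consecutive : ∀ es₁ {e e′ es₂} → Table (es₁ ++ e ∷ e′ ∷ es₂) → e 0F ≡ suc (e′ 0F)
  consecutive []        (step t p _ _) = trans p (cong suc (sym (first-id t)))
  consecutive (_ ∷ [])          (step t _ _ _) = consecutive [] t
  consecutive (_ ∷ es₁@(_ ∷ _)) (step t _ _ _) = consecutive es₁ t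

  last-id : ∀ es₁ {e} → Table (es₁ ++ e ∷ []) → e 0F ≡ 0
  last-id []        t              = first-id t
  last-id (_ ∷ [])          (step t _ _ _) = last-id [] t
  last-id (_ ∷ es₁@(_ ∷ _)) (step t _ _ _) = last-id es₁ t

  ends-with-dummy : ∀ {es} → Table es → ∃ λ pre → flat es ≡ pre ++ encode dummy ++ padding
  ends-with-dummy start = [] , refl
  ends-with-dummy (step {es} {e} t _ _ _) = let pre , p = ends-with-dummy t in
    encode e ++ pre , trans (cong (encode e ++_) p) (sym (++-assoc (encode e) pre _))

  -- Field 0 is left out because `redirect` replaces it by the pointer variable: the windows say
  -- nothing about `θ (4F , 0F)` and `θ (5F , 0F)`.
  instanceOf-cong : ∀ {w e : Entry} → (∀ i → w (suc i) ≡ e (suc i)) → ∀ r ts → instanceOf w r ts ≡ instanceOf e r ts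
  instanceOf-cong p r = map-cong (val-cong λ j → p (5 ↑ʳ inject≤ j (arity≤sum program r)))

  Concludes-cong : ∀ {w e : Entry} {ws} → (∀ i → w (suc i) ≡ e (suc i)) → Concludes e ws → Concludes w ws
  Concludes-cong {w} {e} p (r , q , s) = r , trans (p zero) q , trans (instanceOf-cong {w} {e} p r _) s

  occurrence : ∀ {es} w → Occurs w (flat es) → ∃ λ e → e ∈ es × w ≗ e
  occurrence {es} w (pre , post , eq) =
    let es₁ , e , es₂ , p , w≗e , _ = align-entry es w {pre} {post} eq
    in e , subst (e ∈_) (sym p) (∈-++⁺ʳ es₁ (here refl)) , w≗e

  table⇒locally : ∀ {es} → Table es → Locally (flat es)
  table⇒locally {es} t θ (F₀ ∷ F₁ ∷ F₂ ∷ F₃ ∷ []) = condition⁺ θ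
    (next (subst (λ l → Factor l (flat es)) (template₀-val θ) F₀))
    (within (subst (λ l → Factor l (flat es)) (template₀-val θ) F₀))
    (check (occurrence w₁ (subst (λ l → Factor l (flat es)) (template-val θ _) F₁))
           (occurrence w₂ (subst (λ l → Factor l (flat es)) (template-val θ _) F₂))
           (occurrence w₃ (subst (λ l → Factor l (flat es)) (template-val θ _) F₃)))
    where
    w w₁ w₂ w₃ u ν μ : Entry
    w i = θ (0F , i)
    w₁ i = θ (3F , i)
    w₂ i = val θ (redirect 2F 4F i)
    w₃ i = val θ (redirect 4F 5F i)
    u i = θ (6F , i)
    ν i = θ (1F , i)
    μ i = θ (2F , i)

    window : Factor (encode w ++ successor u ν μ) (flat es) → ∃ λ es₁ → ∃ λ e → ∃ λ es₂ →
      es ≡ es₁ ++ e ∷ es₂ × w ≗ e × ∃ λ post → successor u ν μ ++ post ≡ flat es₂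
    window (pre , post , eq) =
      let es₁ , e , es₂ , p , w≗e , q = align-entry es w {pre} {successor u ν μ ++ post}
            (trans eq (cong (pre ++_) (++-assoc (encode w) (successor u ν μ) post)))
      in es₁ , e , es₂ , p , w≗e , post , q

    within : Factor (encode w ++ successor u ν μ) (flat es) → Within θ
    within F = let es₁ , e , es₂ , p , w≗e , _ = window F in
      transport e w≗e (earlier t (subst (e ∈_) (sym p) (∈-++⁺ʳ es₁ (here refl))))
      where
      transport : ∀ e → w ≗ e → Earlier e → Within θ
      transport e w≗e (inj₁ p)       = inj₁ (trans (w≗e 1F) p)
      transport e w≗e (inj₂ (p , q)) = inj₂
        ( trans (w≗e 0F) (trans p (sym (cong₂ (λ a b → suc (a + b)) (w≗e 2F) (w≗e 3F))))
        , trans (w≗e 0F) (trans q (sym (cong₂ (λ a b → suc (a + b)) (w≗e 4F) (w≗e 5F)))))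

    next : Factor (encode w ++ successor u ν μ) (flat es) → Next θ
    next F = let es₁ , e , es₂ , p , w≗e , post , q = window F in cases es₁ e es₂ p w≗e post q
      where
      cases : ∀ es₁ e es₂ → es ≡ es₁ ++ e ∷ es₂ → w ≗ e → ∀ post → successor u ν μ ++ post ≡ flat es₂ → Next θ
      -- Only padding follows the last record, so the block after it is no record; the index 0
      -- provides the other alternative of `nextᵈ`.
      cases es₁ e []         p w≗e post q = inj₁ (trans (w≗e 0F) (last-id es₁ (subst Table p t)))
      cases es₁ e (e′ ∷ es₂) p w≗e post q =
        let q₁ = ∷-injectiveʳ q
            q₂ = ∷-injectiveʳ q₁
            ν≗e′ , μ≗1 , _ = interleave-++-injective {f = ν} {μ} {e′} {λ _ → 1} {post} (∷-injectiveʳ q₂)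
        in inj₂ ( ∷-injectiveˡ q , ∷-injectiveˡ q₁ , ∷-injectiveˡ q₂
                , trans (w≗e 0F) (trans (consecutive es₁ (subst Table p t)) (cong suc (sym (ν≗e′ 0F)))) , μ≗1)

    supported : ∀ f r (body : (r : Rule) → List (Lin (Fin (arity r)))) {e e′} → w₁ ≗ e → (∀ i → θ (f , suc i) ≡ e′ (suc i)) →
      Concludes e′ (instanceOf e r (body (ruleAt r))) → Concludes (λ i → θ (f , i)) (instanceOf w₁ r (body (ruleAt r)))
    supported f r body {e} {e′} p q c = subst (Concludes (λ i → θ (f , i)))
      (sym (instanceOf-cong {w₁} {e} (p ∘ suc) r (body (ruleAt r)))) (Concludes-cong {λ i → θ (f , i)} {e′} q c)

    check : (∃ λ e → e ∈ es × w₁ ≗ e) → (∃ λ e → e ∈ es × w₂ ≗ e) → (∃ λ e → e ∈ es × w₃ ≗ e) → Check θ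
    check (e , e∈ , p) (e₁ , e₁∈ , p₁) (e₂ , e₂∈ , p₂) =
      let f₁ , f₂ , r , q , f₁∈ , f₂∈ , q₁ , q₂ , c₁ , c₂ = links t e∈
          f₁≡e₁ = id-injective t f₁∈ e₁∈ (trans q₁ (trans (sym (p 2F)) (p₁ 0F)))
          f₂≡e₂ = id-injective t f₂∈ e₂∈ (trans q₂ (trans (sym (p 4F)) (p₂ 0F)))
      in r , trans (p 1F) q
       , supported 4F r body₁ {e} {e₁} p (p₁ ∘ suc) (subst (λ f → Concludes f (instanceOf e r (body₁ (ruleAt r)))) f₁≡e₁ c₁)
       , supported 5F r body₂ {e} {e₂} p (p₂ ∘ suc) (subst (λ f → Concludes f (instanceOf e r (body₂ (ruleAt r)))) f₂≡e₂ c₂)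

  entry : (id rule target₁ slack₁ target₂ slack₂ : ℕ) → ∀ {k} → (Fin k → ℕ) → Entry
  entry a b c d e f θ = a ∷ᶠ b ∷ᶠ c ∷ᶠ d ∷ᶠ e ∷ᶠ f ∷ᶠ extendBy0 θ

  table-infer : ∀ {es e₁ e₂} → Table es → e₁ ∈ es → e₂ ∈ es → ∀ r (θ : Fin (arity (ruleAt r)) → ℕ) →
    Concludes e₁ (map (val θ) (body₁ (ruleAt r))) → Concludes e₂ (map (val θ) (body₂ (ruleAt r))) →
    ∃ λ e → Table (e ∷ es) × e 1F ≡ toℕ r × (∀ j → e (field-of r j) ≡ θ j)
  table-infer {es} {e₁} {e₂} t e₁∈ e₂∈ r θ c₁ c₂ = e ,
    step t refl (inj₂ (slack e₁∈ , slack e₂∈))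
      (refl , e₁∈ , e₂∈ , refl , refl , subst (Concludes e₁) (fields _) c₁ , subst (Concludes e₂) (fields _) c₂) ,
    refl , extendBy0-inject≤ θ (arity≤sum program r)
    where
    -- The truncated subtractions are exact, since every index in `es` is below `length es`, the
    -- index of the new record.
    e = entry (length es) (toℕ r) (e₁ 0F) (length es ∸ suc (e₁ 0F)) (e₂ 0F) (length es ∸ suc (e₂ 0F)) θ

    slack : ∀ {e′} → e′ ∈ es → length es ≡ suc (e′ 0F + (length es ∸ suc (e′ 0F)))
    slack e′∈ = sym (m+[n∸m]≡n (id-bound t e′∈))

    fields : ∀ ts → map (val θ) ts ≡ instanceOf e r ts
    fields = map-cong (val-cong λ j → sym (extendBy0-inject≤ θ (arity≤sum program r) j))

  dummy∈ : ∀ {es} → Table es → dummy ∈ es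
  dummy∈ start          = here refl
  dummy∈ (step t _ _ _) = there (dummy∈ t)

  ∈⇒lookup : ∀ {r} {R′ : List Rule} → r ∈ R′ → ∃ λ i → r ≡ List.lookup R′ i
  ∈⇒lookup r∈ = Any.index r∈ , Any.lookup-index r∈

  -- The table is passed through both premises in turn; the inclusion keeps the record of the first
  -- premise available after the second has been added.
  derivable⇒table : ∀ {ws} → Derivable R ws → ∀ {es} → Table es →
    ∃ λ es′ → Table es′ × es ⊆ es′ × ∃ λ e → e ∈ es′ × Concludes e ws
  derivable⇒table axiom {es} t = es , t , id , dummy , dummy∈ t , zero , refl , refl
  derivable⇒table (infer r∈ θ refl refl refl d₁ d₂) {es} t with ∈⇒lookup r∈
  ... | i , refl =
    let es₁ , t₁ , ⊆₁ , e₁ , e₁∈ , c₁ = derivable⇒table d₁ t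
        es₂ , t₂ , ⊆₂ , e₂ , e₂∈ , c₂ = derivable⇒table d₂ t₁
        e , t₃ , p , q = table-infer t₂ (⊆₂ e₁∈) e₂∈ (suc (suc i)) θ c₁ c₂
    in e ∷ es₂ , t₃ , there ∘ ⊆₂ ∘ ⊆₁ , e , here refl , suc (suc i) , p , map-cong (val-cong q) _

  certificate : ∀ θ → Derivable R (map (val θ) goal) →
    ∃ λ ns → Locally ns × (∃ λ pre → ns ≡ pre ++ encode dummy ++ padding) ×
    ∃ λ q → ∃ λ rest → ns ≡ encode q ++ rest × q 1F ≡ 1 × ∀ j → q (field-of (suc zero) j) ≡ θ j
  certificate θ d =
    let es , t , _ , e , e∈ , c = derivable⇒table d start
        -- The root rule has second premise `[]`, for which it points to the dummy.
        q , t′ , p , s = table-infer t e∈ (dummy∈ t) (suc zero) θ c (zero , refl , refl)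
    in flat (q ∷ es) , table⇒locally t′ , ends-with-dummy t′ , q , flat es , refl , p , s

private variable
  V′ : Set

-- Lists of numbers as words

module Words {A : Set} (_≟_ : DecidableEquality A) {a b : A} (a≢b : a ≢ b)
  (K : List A) (cover : ∀ c → c ≡ a ⊎ c ≡ b ⊎ c ∈ K) (a∉K : a ∉ K) (b∉K : b ∉ K) where

  Word : Set
  Word = List A

  un : ℕ → Word
  un n = replicate n a

  enc : List ℕ → Word
  enc []       = []
  enc (n ∷ ns) = b ∷ un n ++ enc ns

  -- The closing b delimits the last number, so that a factor `enc ms` followed by b matches whole
  -- numbers and not the beginning of a longer one.
  encb : List ℕ → Word
  encb ns = enc ns ++ b ∷ []

  un-+ : ∀ m n → un (m + n) ≡ un m ++ un n
  un-+ zero    n = refl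
  un-+ (suc m) n = cong (a ∷_) (un-+ m n)

  enc-++ : ∀ ms ns → enc (ms ++ ns) ≡ enc ms ++ enc ns
  enc-++ []       ns = refl
  enc-++ (m ∷ ms) ns = cong (b ∷_) (trans (cong (un m ++_) (enc-++ ms ns)) (sym (++-assoc (un m) (enc ms) _)))

  encb-++ : ∀ ms ns → encb (ms ++ ns) ≡ enc ms ++ encb ns
  encb-++ ms ns = trans (cong (_++ b ∷ []) (enc-++ ms ns)) (++-assoc (enc ms) _ _)

  encb-head : ∀ ns → ∃ λ w → encb ns ≡ b ∷ w
  encb-head []       = [] , refl
  encb-head (n ∷ ns) = _ , refl

  un-cancel : ∀ m n {w w′} → un m ++ b ∷ w ≡ un n ++ b ∷ w′ → m ≡ n × w ≡ w′
  un-cancel zero    zero    e = refl , ∷-injectiveʳ e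
  un-cancel zero    (suc n) e = contradiction (sym (∷-injectiveˡ e)) a≢b
  un-cancel (suc m) zero    e = contradiction (∷-injectiveˡ e) a≢b
  un-cancel (suc m) (suc n) e = let p , q = un-cancel m n (∷-injectiveʳ e) in cong suc p , q

  encb-prefix : ∀ ns ms {w} → encb ns ≡ enc ms ++ b ∷ w → ∃ λ rest → ns ≡ ms ++ rest × encb rest ≡ b ∷ w
  encb-prefix ns       []       e = ns , refl , e
  encb-prefix []       (m ∷ ms) e with () ← ++-conicalʳ (un m ++ enc ms) _ (sym (∷-injectiveʳ e))
  encb-prefix (n ∷ ns) (m ∷ ms) {w} e =
    let w₁ , p₁ = encb-head ns
        w₂ , p₂ = enc-head ms
        q , r = un-cancel n m (begin
          un n ++ b ∷ w₁          ≡⟨ cong (un n ++_) (sym p₁) ⟩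
          un n ++ encb ns         ≡⟨ sym (++-assoc (un n) (enc ns) _) ⟩
          (un n ++ enc ns) ++ _   ≡⟨ ∷-injectiveʳ e ⟩
          (un m ++ enc ms) ++ _   ≡⟨ ++-assoc (un m) (enc ms) _ ⟩
          un m ++ enc ms ++ _     ≡⟨ cong (un m ++_) p₂ ⟩
          un m ++ b ∷ w₂          ∎)
        rest , s , t = encb-prefix ns ms (trans p₁ (trans (cong (b ∷_) r) (sym p₂)))
    in rest , cong₂ _∷_ q s , t
    where
    open ≡-Reasoning
    enc-head : ∀ ms → ∃ λ w′ → enc ms ++ b ∷ w ≡ b ∷ w′
    enc-head []       = w , refl
    enc-head (m ∷ ms) = _ , refl

  encb≡[b] : ∀ ns → encb ns ≡ b ∷ [] → ns ≡ []
  encb≡[b] []       e = refl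
  encb≡[b] (n ∷ ns) e with () ← ++-conicalʳ (un n ++ enc ns) (b ∷ []) (∷-injectiveʳ e)

  encb-injective : ∀ ns ms → encb ns ≡ encb ms → ns ≡ ms
  encb-injective ns ms e = let rest , p , q = encb-prefix ns ms e in
    trans p (trans (cong (ms ++_) (encb≡[b] rest q)) (++-identityʳ ms))

  -- The word `y` is removed letter by letter; `un n` is what remains of the number currently being
  -- crossed.
  encb-suffix : ∀ n ns y {w} → un n ++ encb ns ≡ y ++ b ∷ w →
    ∃ λ pre → ∃ λ post → ns ≡ pre ++ post × encb post ≡ b ∷ w
  encb-suffix zero    ns       []      e = [] , ns , refl , e
  encb-suffix (suc n) ns       []      e = contradiction (∷-injectiveˡ e) a≢b
  encb-suffix (suc n) ns       (_ ∷ y) e = encb-suffix n ns y (∷-injectiveʳ e)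
  encb-suffix zero    []       (_ ∷ y) e with () ← ++-conicalʳ y _ (sym (∷-injectiveʳ e))
  encb-suffix zero    (n ∷ ns) (_ ∷ y) e =
    let pre , post , p , q = encb-suffix n ns y (trans (sym (++-assoc (un n) (enc ns) _)) (∷-injectiveʳ e))
    in n ∷ pre , post , cong (n ∷_) p , q

  window⇒factor : ∀ ns y m ms {w} → encb ns ≡ y ++ enc (m ∷ ms) ++ b ∷ w → Factor (m ∷ ms) ns
  window⇒factor ns y m ms e =
    let pre , post , p , q = encb-suffix 0 ns y e
        rest , r , _ = encb-prefix post (m ∷ ms) q
    in pre , rest , trans p (cong (pre ++_) r)

  Window : List ℕ → Word → Set
  Window ms x = ∃ λ y → ∃ λ w → x ≡ y ++ enc ms ++ b ∷ w

  factor⇒window : ∀ {ms ns} → Factor ms ns → Window ms (encb ns)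
  factor⇒window {ms} {ns} (pre , post , e) = let w , p = encb-head post in enc pre , w , (begin
    encb ns                        ≡⟨ cong encb e ⟩
    encb (pre ++ ms ++ post)       ≡⟨ encb-++ pre (ms ++ post) ⟩
    enc pre ++ encb (ms ++ post)   ≡⟨ cong (enc pre ++_) (trans (encb-++ ms post) (cong (enc ms ++_) p)) ⟩
    enc pre ++ enc ms ++ b ∷ w     ∎)
    where open ≡-Reasoning

  parse : ∀ w → (∀ {c} → c ∈ w → c ≡ a ⊎ c ≡ b) → ∃ λ n → ∃ λ ns → w ++ b ∷ [] ≡ un n ++ encb ns
  parse []      h = 0 , [] , refl
  parse (c ∷ w) h with h (here refl) | parse w (h ∘ there)
  ... | inj₁ refl | n , ns , e = suc n , ns , cong (a ∷_) e
  ... | inj₂ refl | n , ns , e = 0 , n ∷ ns , cong (b ∷_) (trans e (sym (++-assoc (un n) (enc ns) _)))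

  enc-starts : ∀ ns {c w} → c ∷ w ≡ enc ns → c ≡ b
  enc-starts (n ∷ ns) e = ∷-injectiveˡ e

  encb-letters : ∀ ns {c} → c ∈ encb ns → c ≡ a ⊎ c ≡ b
  encb-letters []       (here p)  = inj₂ p
  encb-letters (n ∷ ns) (here p)  = inj₂ p
  encb-letters (n ∷ ns) (there c∈) with ∈-++⁻ (un n) (subst (_ ∈_) (++-assoc (un n) (enc ns) _) c∈)
  ... | inj₁ c∈un = inj₁ (All.lookup (All.replicate⁺ {P = _≡ a} n refl) c∈un)
  ... | inj₂ c∈ns = encb-letters ns c∈ns

  commutes⇒power : ∀ w → w ++ a ∷ [] ≡ a ∷ w → w ≡ un (length w)
  commutes⇒power []      e = refl
  commutes⇒power (c ∷ w) e with refl ← ∷-injectiveˡ e = cong (a ∷_) (commutes⇒power w (∷-injectiveʳ e))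

  power-commutes : ∀ n → un n ++ a ∷ [] ≡ a ∷ un n
  power-commutes zero    = refl
  power-commutes (suc n) = cong (a ∷_) (power-commutes n)

  extend-++ : ∀ (σ : V → Word) U U′ → extend σ (U ++ U′) ≡ extend σ U ++ extend σ U′
  extend-++ σ U U′ = concatMap-++ [ [_] , σ ]′ U U′

  constant : Word → Pattern A V
  constant = map inj₁

  extend-constant : ∀ (σ : V → Word) w → extend σ (constant w) ≡ w
  extend-constant σ []      = refl
  extend-constant σ (c ∷ w) = cong (c ∷_) (extend-constant σ w)

  linᵖ : (V → V′) → Lin V → Pattern A V′
  linᵖ ρ (lit n) = constant (un n)
  linᵖ ρ (var v) = inj₂ (ρ v) ∷ []
  linᵖ ρ (t ⊕ u) = linᵖ ρ t ++ linᵖ ρ u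

  encᵖ : (V → V′) → List (Lin V) → Pattern A V′
  encᵖ ρ []       = []
  encᵖ ρ (t ∷ ts) = inj₁ b ∷ linᵖ ρ t ++ encᵖ ρ ts

  module _ {σ : V′ → Word} {ρ : V → V′} {θ : V → ℕ} (σ-ρ : ∀ v → σ (ρ v) ≡ un (θ v)) where

    extend-linᵖ : ∀ t → extend σ (linᵖ ρ t) ≡ un (val θ t)
    extend-linᵖ (lit n) = extend-constant σ (un n)
    extend-linᵖ (var v) = trans (++-identityʳ _) (σ-ρ v)
    extend-linᵖ (t ⊕ u) = begin
      extend σ (linᵖ ρ t ++ linᵖ ρ u)            ≡⟨ extend-++ σ (linᵖ ρ t) (linᵖ ρ u) ⟩
      extend σ (linᵖ ρ t) ++ extend σ (linᵖ ρ u) ≡⟨ cong₂ _++_ (extend-linᵖ t) (extend-linᵖ u) ⟩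
      un (val θ t) ++ un (val θ u)               ≡⟨ sym (un-+ (val θ t) (val θ u)) ⟩
      un (val θ t + val θ u)                     ∎
      where open ≡-Reasoning

    extend-encᵖ : ∀ ts → extend σ (encᵖ ρ ts) ≡ enc (map (val θ) ts)
    extend-encᵖ []       = refl
    extend-encᵖ (t ∷ ts) = cong (b ∷_) (trans (extend-++ σ (linᵖ ρ t) (encᵖ ρ ts))
                                             (cong₂ _++_ (extend-linᵖ t) (extend-encᵖ ts)))

  satisfies? : ∀ (σ : V → Word) l → Dec (σ ⊨ l)
  satisfies? σ (U ≐ U′)  = ≡-dec _≟_ (extend σ U) (extend σ U′)
  satisfies? σ (U ≐̸ U′) = ¬? (≡-dec _≟_ (extend σ U) (extend σ U′))

  lookupD : List Word → ℕ → Word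
  lookupD []       _       = []
  lookupD (w ∷ ws) zero    = w
  lookupD (w ∷ ws) (suc n) = lookupD ws n

  lookupD-tabulate : ∀ {m} (f : Fin m → Word) ws i → lookupD (tabulate f ++ ws) (toℕ i) ≡ f i
  lookupD-tabulate f ws zero    = refl
  lookupD-tabulate f ws (suc i) = lookupD-tabulate (f ∘ suc) ws i

  lookupD-++ : ∀ {m} (f : Fin m → Word) ws n → lookupD (tabulate f ++ ws) (m + n) ≡ lookupD ws n
  lookupD-++ {zero}  f ws n = refl
  lookupD-++ {suc m} f ws n = lookupD-++ (f ∘ suc) ws n

  powers-commute : ∀ (σ : V → Word) v → σ v ++ a ∷ [] ≡ a ∷ σ v → σ ⊨ (inj₂ v ∷ inj₁ a ∷ []) ≐ (inj₁ a ∷ inj₂ v ∷ [])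
  powers-commute σ v e = trans e (cong (a ∷_) (sym (++-identityʳ (σ v))))

  commute-power : ∀ (σ : V → Word) v → σ ⊨ (inj₂ v ∷ inj₁ a ∷ []) ≐ (inj₁ a ∷ inj₂ v ∷ []) → σ v ≡ un (length (σ v))
  commute-power σ v e = commutes⇒power (σ v) (trans e (cong (a ∷_) (++-identityʳ (σ v))))

  -- A local condition as a clause of unsat-equations

  module Clause {V : Set} {M : ℕ} (index : V → Fin M) (member : Fin M → V) (member-index : ∀ v → member (index v) ≡ v)
    (T : List (List (Lin V))) (D : DNF V) where

    Local : List ℕ → Set
    Local ns = ∀ θ → All (λ t → Factor (map (val θ) t) ns) T → ⟦ D ⟧ θ

    Letter : Set
    Letter = A ⊎ (X ⊎ Y)

    x̂ : Letter
    x̂ = inj₂ (inj₁ 0)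

    ŷ : ℕ → Letter
    ŷ j = inj₂ (inj₂ j)

    -- The variables from M on: z, its two contexts in x and its two contexts in K, the contexts of the windows.
    ẑ : ℕ → Letter
    ẑ j = ŷ (M + j)

    ρ : V → X ⊎ Y
    ρ v = inj₂ (toℕ (index v))

    unaryLiteral : Fin M → Literal A (X ⊎ Y)
    unaryLiteral i = (ŷ (toℕ i) ∷ inj₁ a ∷ []) ≐ (inj₁ a ∷ ŷ (toℕ i) ∷ [])

    -- They make z a common factor of x and K.  No such z ≠ ε satisfies a conclusion, whose right-hand
    -- side starts with b, so the clause also confines x to the letters a and b.
    gapLiterals : List (Literal A (X ⊎ Y))
    gapLiterals = ((x̂ ∷ []) ≐ (ẑ 1 ∷ ẑ 0 ∷ ẑ 2 ∷ [])) ∷ (constant K ≐ (ẑ 3 ∷ ẑ 0 ∷ ẑ 4 ∷ [])) ∷ []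

    windowLiterals : ℕ → List (List (Lin V)) → List (Literal A (X ⊎ Y))
    windowLiterals j []       = []
    windowLiterals j (t ∷ ts) =
      ((x̂ ∷ []) ≐ (ẑ j ∷ encᵖ ρ t ++ inj₁ b ∷ ẑ (suc j) ∷ [])) ∷ windowLiterals (2 + j) ts

    -- Failure of this literal asserts an equation. As `enc` separates the numbers by b, one
    -- equation of words carries a whole conjunction when `z` is empty; this is why the condition is
    -- kept as a disjunction of conjunctions.
    conclusion : List (Lin V × Lin V) → Literal A (X ⊎ Y)
    conclusion c = (ẑ 0 ∷ encᵖ ρ (map proj₁ c)) ≐̸ encᵖ ρ (map proj₂ c)

    hypotheses clause : List (Literal A (X ⊎ Y))
    -- The variables 0 to 4 after the numbers are `z` and its four contexts, so the windows begin at
    -- 5.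
    hypotheses = tabulate unaryLiteral ++ gapLiterals ++ windowLiterals 5 T
    clause     = hypotheses ++ map conclusion D

    Refuted : (X → Word) → Set
    Refuted σ = (τ : Y → Word) → Any (λ f → ¬ ([ σ , τ ]′ ⊨ f)) clause

    Solves⁺ : ∀ {θ : V → ℕ} c → map (val θ) (map proj₁ c) ≡ map (val θ) (map proj₂ c) → All (Solves θ) c
    Solves⁺ []      e = []
    Solves⁺ (_ ∷ c) e = ∷-injectiveˡ e ∷ Solves⁺ c (∷-injectiveʳ e)

    Solves⁻ : ∀ {θ : V → ℕ} c → All (Solves θ) c → map (val θ) (map proj₁ c) ≡ map (val θ) (map proj₂ c)
    Solves⁻ []      []       = refl
    Solves⁻ (_ ∷ c) (p ∷ ps) = cong₂ _∷_ p (Solves⁻ c ps)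

    module _ {σ : X → Word} where

      private
        x = σ 0

      window-intro : ∀ τ {θ : V → ℕ} → (∀ v → τ (toℕ (index v)) ≡ un (θ v)) → ∀ j t {y w} →
        τ (M + j) ≡ y → τ (M + suc j) ≡ w → x ≡ y ++ enc (map (val θ) t) ++ b ∷ w →
        [ σ , τ ]′ ⊨ (x̂ ∷ []) ≐ (ẑ j ∷ encᵖ ρ t ++ inj₁ b ∷ ẑ (suc j) ∷ [])
      window-intro τ h j t refl refl e = trans (++-identityʳ x) (trans e (cong (τ (M + j) ++_) (sym
        (trans (extend-++ [ σ , τ ]′ (encᵖ ρ t) _) (cong₂ _++_ (extend-encᵖ {ρ = ρ} h t) (cong (b ∷_) (++-identityʳ _)))))))

      window-elim : ∀ τ {θ : V → ℕ} → (∀ v → τ (toℕ (index v)) ≡ un (θ v)) → ∀ j t →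
        [ σ , τ ]′ ⊨ (x̂ ∷ []) ≐ (ẑ j ∷ encᵖ ρ t ++ inj₁ b ∷ ẑ (suc j) ∷ []) → Window (map (val θ) t) x
      window-elim τ h j t e = τ (M + j) , τ (M + suc j) , trans (sym (++-identityʳ x)) (trans e (cong (τ (M + j) ++_)
        (trans (extend-++ [ σ , τ ]′ (encᵖ ρ t) _) (cong₂ _++_ (extend-encᵖ {ρ = ρ} h t) (cong (b ∷_) (++-identityʳ _))))))

      contexts : ∀ {θ : V → ℕ} {T′} → All (λ t → Window (map (val θ) t) x) T′ → List Word
      contexts []                  = []
      contexts ((y , w , _) ∷ ws) = y ∷ w ∷ contexts ws

      windows-intro : ∀ τ {θ : V → ℕ} → (∀ v → τ (toℕ (index v)) ≡ un (θ v)) → ∀ j {T′}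
        (ws : All (λ t → Window (map (val θ) t) x) T′) → (∀ i → τ (M + (j + i)) ≡ lookupD (contexts ws) i) →
        All ([ σ , τ ]′ ⊨_) (windowLiterals j T′)
      windows-intro τ h j []       e = []
      windows-intro τ h j {t ∷ _} ((y , w , p) ∷ ws) e =
        window-intro τ h j t
          (trans (cong (λ i → τ (M + i)) (sym (+-identityʳ j))) (e 0))
          (trans (cong (λ i → τ (M + i)) (sym (+-comm j 1))) (e 1)) p
        ∷ windows-intro τ h (2 + j) ws λ i →
          trans (cong (λ i → τ (M + i)) (sym (trans (+-suc j (suc i)) (cong suc (+-suc j i))))) (e (2 + i))

      windows-elim : ∀ τ {θ : V → ℕ} → (∀ v → τ (toℕ (index v)) ≡ un (θ v)) → ∀ j T′ →
        All ([ σ , τ ]′ ⊨_) (windowLiterals j T′) → All (λ t → Window (map (val θ) t) x) T′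
      windows-elim τ h j []       []       = []
      windows-elim τ h j (t ∷ T′) (p ∷ ps) = window-elim τ h j t p ∷ windows-elim τ h (2 + j) T′ ps

      -- The data define an assignment satisfying all hypotheses, so the failing literal is a
      -- conclusion. It fails by a double negation, which can be removed because equality of words
      -- is decidable.
      refuted⇒conclusion : Refuted σ → ∀ θ {z z₁ z₂ z₃ z₄} → x ≡ z₁ ++ z ++ z₂ → K ≡ z₃ ++ z ++ z₄ →
        All (λ t → Window (map (val θ) t) x) T →
        Any (λ c → z ++ enc (map (val θ) (map proj₁ c)) ≡ enc (map (val θ) (map proj₂ c))) D
      refuted⇒conclusion refuted θ {z} {z₁} {z₂} {z₃} {z₄} p q ws =
        Any.map (λ {c} → convert c) (Any.map⁻ (in-conclusions (Any.++⁻ hypotheses (refuted τ))))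
        where
        powers : Fin M → Word
        powers i = un (θ (member i))
        scalars : List Word
        scalars = z ∷ z₁ ∷ z₂ ∷ z₃ ∷ z₄ ∷ contexts ws
        τ : Y → Word
        τ = lookupD (tabulate powers ++ scalars)

        τ-power : ∀ i → τ (toℕ i) ≡ powers i
        τ-power = lookupD-tabulate powers scalars

        τ-scalar : ∀ j → τ (M + j) ≡ lookupD scalars j
        τ-scalar = lookupD-++ powers scalars

        τ-var : ∀ v → τ (toℕ (index v)) ≡ un (θ v)
        τ-var v = trans (τ-power (index v)) (cong (un ∘ θ) (member-index v))

        concat₃ : ∀ {u₁ u₂ u₃} j₁ j₂ j₃ → τ (M + j₁) ≡ u₁ → τ (M + j₂) ≡ u₂ → τ (M + j₃) ≡ u₃ →
          extend [ σ , τ ]′ (ẑ j₁ ∷ ẑ j₂ ∷ ẑ j₃ ∷ []) ≡ u₁ ++ u₂ ++ u₃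
        concat₃ j₁ j₂ j₃ e₁ e₂ e₃ = cong₂ _++_ e₁ (cong₂ _++_ e₂ (trans (++-identityʳ _) e₃))

        hypotheses-hold : All ([ σ , τ ]′ ⊨_) hypotheses
        hypotheses-hold = All.++⁺ (All.tabulate⁺ {f = unaryLiteral} λ i → powers-commute [ σ , τ ]′ (inj₂ (toℕ i))
            (trans (cong (_++ a ∷ []) (τ-power i)) (trans (power-commutes (θ (member i))) (cong (a ∷_) (sym (τ-power i))))))
          ( trans (++-identityʳ x) (trans p (sym (concat₃ 1 0 2 (τ-scalar 1) (τ-scalar 0) (τ-scalar 2))))
          ∷ trans (extend-constant [ σ , τ ]′ K) (trans q (sym (concat₃ 3 0 4 (τ-scalar 3) (τ-scalar 0) (τ-scalar 4))))
          ∷ windows-intro τ τ-var 5 ws (λ i → τ-scalar (5 + i)))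

        in-conclusions : Any (λ f → ¬ ([ σ , τ ]′ ⊨ f)) hypotheses ⊎ Any (λ f → ¬ ([ σ , τ ]′ ⊨ f)) (map conclusion D) →
          Any (λ f → ¬ ([ σ , τ ]′ ⊨ f)) (map conclusion D)
        in-conclusions (inj₁ fails) = contradiction hypotheses-hold (All.Any¬⇒¬All fails)
        in-conclusions (inj₂ d)     = d

        convert : ∀ c → ¬ ([ σ , τ ]′ ⊨ conclusion c) → z ++ enc (map (val θ) (map proj₁ c)) ≡ enc (map (val θ) (map proj₂ c))
        convert c ¬¬e = trans (sym (cong₂ _++_ (τ-scalar 0) (extend-encᵖ {σ = [ σ , τ ]′} {ρ = ρ} τ-var (map proj₁ c))))
          (trans (decidable-stable (≡-dec _≟_ _ _) ¬¬e) (extend-encᵖ {σ = [ σ , τ ]′} {ρ = ρ} τ-var (map proj₂ c)))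

      -- The clause is used twice. With `z` a single letter of `K` occurring in `x`, and the windows
      -- of `θ₀`, it excludes foreign letters; then `x` can be parsed, its first letter b ruling out
      -- an initial block of a's. With `z` empty it gives the local condition.
      sound : Refuted σ → ∀ {x′ x″} → x ≡ x′ ++ b ∷ [] → x ≡ b ∷ x″ →
        ∀ θ₀ → All (λ t → Window (map (val θ₀) t) x) T → ∃ λ ns → x ≡ encb ns × Local ns
      sound refuted {x′} p q θ₀ ws = close (parse x′ (λ c∈ → letters (subst (_ ∈_) (sym p) (∈-++⁺ˡ c∈))))
        where
        letters : ∀ {c} → c ∈ x → c ≡ a ⊎ c ≡ b
        letters {c} c∈ with cover c
        ... | inj₁ c≡a        = inj₁ c≡a
        ... | inj₂ (inj₁ c≡b) = inj₂ c≡b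
        ... | inj₂ (inj₂ c∈K) =
          let _ , _ , e  = ∈-∃++ c∈
              _ , _ , e′ = ∈-∃++ c∈K
              d , p      = Any.satisfied (refuted⇒conclusion refuted θ₀ {z = c ∷ []} e e′ ws)
          in inj₂ (enc-starts _ p)

        close : (∃ λ n → ∃ λ ns → x′ ++ b ∷ [] ≡ un n ++ encb ns) → ∃ λ ns → x ≡ encb ns × Local ns
        close (suc n , ns , e) = contradiction (∷-injectiveˡ (trans (sym e) (trans (sym p) q))) a≢b
        close (zero  , ns , e) = ns , trans p e , λ θ factors →
          Any.map (λ {c} eq → Solves⁺ c (encb-injective _ _ (cong (_++ b ∷ []) eq)))
            (refuted⇒conclusion refuted θ {z = []} {[]} {x} {[]} {K} refl refl
              (All.map (λ F → subst (Window _) (sym (trans p e)) (factor⇒window F)) factors))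

      -- Either a hypothesis fails, or the number variables are powers of a and `z` is empty: its
      -- letters would lie in `x`, which uses only a and b, and in `K`, which contains neither.
      complete : ∀ ns → x ≡ encb ns → Local ns → Refuted σ
      complete ns x≡ local τ with All.all? (satisfies? [ σ , τ ]′) hypotheses
      ... | no ¬all = Any.++⁺ˡ (All.¬All⇒Any¬ (satisfies? [ σ , τ ]′) hypotheses ¬all)
      ... | yes all = Any.++⁺ʳ hypotheses (Any.map⁺ (Any.map (λ {c} s ne → ne (convert c s)) (local θ factors)))
        where
        θ : V → ℕ
        θ v = length (τ (toℕ (index v)))

        powers = All.++⁻ˡ (tabulate unaryLiteral) all
        others = All.++⁻ʳ (tabulate unaryLiteral) all

        τ-var : ∀ v → τ (toℕ (index v)) ≡ un (θ v)
        τ-var v = commute-power [ σ , τ ]′ (inj₂ (toℕ (index v))) (All.tabulate⁻ {f = unaryLiteral} powers (index v))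

        to-factor : ∀ ms → Window ms x → Factor ms ns
        to-factor []       _           = [] , ns , refl
        to-factor (m ∷ ms) (y , w , e) = window⇒factor ns y m ms (trans (sym x≡) e)

        factors : All (λ t → Factor (map (val θ) t) ns) T
        factors = All.map (to-factor _) (windows-elim τ τ-var 5 T (All.++⁻ʳ gapLiterals others))

        z = τ (M + 0)

        z∈x : ∀ {c} → c ∈ z → c ∈ x
        z∈x c∈ = subst (_ ∈_) (trans (sym (All.head others)) (++-identityʳ x)) (∈-++⁺ʳ (τ (M + 1)) (∈-++⁺ˡ c∈))

        z∈K : ∀ {c} → c ∈ z → c ∈ K
        z∈K c∈ = subst (_ ∈_) (trans (sym (All.head (All.tail others))) (extend-constant [ σ , τ ]′ K))
          (∈-++⁺ʳ (τ (M + 3)) (∈-++⁺ˡ c∈))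

        z≡[] : ∀ w → (∀ {c} → c ∈ w → c ∈ z) → w ≡ []
        z≡[] []      h = refl
        z≡[] (c ∷ w) h with encb-letters ns (subst (c ∈_) x≡ (z∈x (h (here refl))))
        ... | inj₁ refl = contradiction (z∈K (h (here refl))) a∉K
        ... | inj₂ refl = contradiction (z∈K (h (here refl))) b∉K

        convert : ∀ c → All (Solves θ) c → extend [ σ , τ ]′ (ẑ 0 ∷ encᵖ ρ (map proj₁ c)) ≡ extend [ σ , τ ]′ (encᵖ ρ (map proj₂ c))
        convert c s = begin
          z ++ extend [ σ , τ ]′ (encᵖ ρ (map proj₁ c))   ≡⟨ cong (_++ extend [ σ , τ ]′ (encᵖ ρ (map proj₁ c))) (z≡[] z id) ⟩
          extend [ σ , τ ]′ (encᵖ ρ (map proj₁ c))        ≡⟨ extend-encᵖ {ρ = ρ} τ-var (map proj₁ c) ⟩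
          enc (map (val θ) (map proj₁ c))                 ≡⟨ cong enc (Solves⁻ c s) ⟩
          enc (map (val θ) (map proj₂ c))                 ≡⟨ sym (extend-encᵖ {ρ = ρ} τ-var (map proj₂ c)) ⟩
          extend [ σ , τ ]′ (encᵖ ρ (map proj₂ c))        ∎
          where open ≡-Reasoning

-- Two distinguished letters and the remaining ones

module Alphabet {A : Set} {k : ℕ} (enum : A ↔ Fin (2 + k)) where
  open Inverse enum

  to-injective : ∀ {c d} → to c ≡ to d → c ≡ d
  to-injective e = trans (sym (strictlyInverseʳ _)) (trans (cong from e) (strictlyInverseʳ _))

  from-injective : ∀ {i j} → from i ≡ from j → i ≡ j
  from-injective e = trans (sym (strictlyInverseˡ _)) (trans (cong to e) (strictlyInverseˡ _))

  _≟_ : DecidableEquality A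
  c ≟ d = map′ to-injective (cong to) (to c Fin.≟ to d)

  a b : A
  a = from 0F
  b = from 1F

  exactly : X → ℕ → Literal A X
  exactly v n = (inj₂ v ∷ []) ≐ map inj₁ (replicate n a)

  others : List A
  others = tabulate (λ i → from (suc (suc i)))

  cover : ∀ c → c ≡ a ⊎ c ≡ b ⊎ c ∈ others
  cover c with to c | strictlyInverseʳ c
  ... | zero        | e = inj₁ (sym e)
  ... | suc zero    | e = inj₂ (inj₁ (sym e))
  ... | suc (suc i) | e = inj₂ (inj₂ (subst (_∈ others) e (∈-tabulate⁺ {f = λ i → from (suc (suc i))} i)))

  a≢b : a ≢ b
  a≢b e with () ← from-injective e

  a∉others : a ∉ others
  a∉others a∈ with i , e ← ∈-tabulate⁻ {f = λ i → from (suc (suc i))} a∈ with () ← from-injective e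

  b∉others : b ∉ others
  b∉others b∈ with i , e ← ∈-tabulate⁻ {f = λ i → from (suc (suc i))} b∈ with () ← from-injective e

-- The system attached to a Horn program and a goal

module Reduction {A : Set} {k : ℕ} (enum : A ↔ Fin (2 + k))
  (R : List Rule) {g : ℕ} (goal : List (Lin (Fin g))) where

  open Alphabet enum
  open Words _≟_ a≢b others cover a∉others b∉others
  open Certificates R goal
  private module C = Clause {V = Var} {7 * size} (λ (f , i) → combine f i) (remQuot size)
            (λ (f , i) → Fin.remQuot-combine f i) templates condition
  open C public using (clause; Local)

  -- The variables 0, 1 and 2 are x, what follows the root record in x, and what precedes the dummy in x.
  field-variable : Fin size → X
  field-variable i = 3 + toℕ i

  rootTemplate : List (Lin (Fin size))
  rootTemplate = block (lit 0) (lit 0) (lit 1) var (λ _ → lit 1)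

  fieldLiteral : Fin size → Literal A X
  fieldLiteral i = (inj₂ (field-variable i) ∷ inj₁ a ∷ []) ≐ (inj₁ a ∷ inj₂ (field-variable i) ∷ [])

  rootLiterals : List (Literal A X)
  rootLiterals =
    ((inj₂ 0 ∷ []) ≐ (encᵖ field-variable rootTemplate ++ inj₁ b ∷ inj₂ 1 ∷ [])) ∷
    ((inj₂ 0 ∷ []) ≐ (inj₂ 2 ∷ constant (encb (encode dummy ++ padding)))) ∷
    -- Rule 1 is the root rule, with the goal as premise; the goal's variables thereby become fields
    -- of the first record, accessible to sat-equations.
    exactly (field-variable 1F) 1 ∷
    tabulate fieldLiteral

  input-variable : Fin g → X
  input-variable j = field-variable (field-of (suc zero) j)

  root-val : ∀ θ → map (val θ) rootTemplate ≡ encode θ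
  root-val θ = map-block (val θ) (lit 0) (lit 0) (lit 1) var (λ _ → lit 1)

  replicate-injective : ∀ {m n} → replicate m a ≡ replicate n a → m ≡ n
  replicate-injective {zero}  {zero}  e = refl
  replicate-injective {suc m} {suc n} e = cong suc (replicate-injective (List.∷-injectiveʳ e))
    where import Data.List.Properties as List

  satisfiable⇒derivable : ∀ {σ : X → List A} → All (σ ⊨_) rootLiterals → C.Refuted σ →
    ∃ λ θ → (∀ j n → σ ⊨ exactly (input-variable j) n → θ j ≡ n) × Derivable R (map (val θ) goal)
  satisfiable⇒derivable {σ} (root ∷ end ∷ rule₁ ∷ fields) refuted =
    (λ j → q (field-of (suc zero) j)) , (λ j n → read (field-of (suc zero) j) n) , derivable
    where
    x = σ 0
    q : Entry
    q i = length (σ (field-variable i))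

    powers : ∀ i → σ (field-variable i) ≡ replicate (q i) a
    powers i = commute-power σ (field-variable i) (All.tabulate⁻ {f = fieldLiteral} fields i)

    read : ∀ i n → σ ⊨ exactly (field-variable i) n → q i ≡ n
    read i n e = replicate-injective (trans (sym (powers i))
      (trans (sym (++-identityʳ _)) (trans e (extend-constant σ (replicate n a)))))

    ends : List ℕ
    ends = encode dummy ++ padding

    x-root : x ≡ enc (encode q) ++ b ∷ σ 1
    x-root = begin
      x                                                        ≡⟨ sym (++-identityʳ x) ⟩
      x ++ []                                                  ≡⟨ root ⟩
      extend σ (encᵖ field-variable rootTemplate ++ _)         ≡⟨ extend-++ σ (encᵖ field-variable rootTemplate) _ ⟩
      extend σ (encᵖ field-variable rootTemplate) ++ b ∷ σ 1 ++ []
        ≡⟨ cong₂ _++_ (trans (extend-encᵖ {ρ = field-variable} powers rootTemplate) (cong enc (root-val q)))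
                      (cong (b ∷_) (++-identityʳ (σ 1))) ⟩
      enc (encode q) ++ b ∷ σ 1                                ∎
      where open ≡-Reasoning

    x-end : x ≡ σ 2 ++ encb ends
    x-end = trans (sym (++-identityʳ x)) (trans end (cong (σ 2 ++_) (extend-constant σ (encb ends))))

    -- These windows lie in the prescribed end of `x`, the only part besides the root record that is
    -- known before the clause has been applied.
    windows : ∀ {ms} → Factor ms ends → Window ms x
    windows F = let y , w , p = factor⇒window F in
      σ 2 ++ y , w , trans x-end (trans (cong (σ 2 ++_) p) (sym (++-assoc (σ 2) y _)))

    parsed : ∃ λ ns → x ≡ encb ns × Local ns
    parsed = C.sound refuted (trans x-end (sym (++-assoc (σ 2) (enc ends) _))) x-root
      (proj₁ dummy-windows) (All.map windows (proj₂ dummy-windows))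

    derivable : Derivable R (instanceOf q (suc zero) goal)
    derivable =
      let ns , x≡ , local = parsed
          rest , p , _ = encb-prefix ns (encode q) (trans (sym x≡) x-root)
          pre , post , r , s = encb-suffix 0 ns (σ 2) (trans (sym x≡) x-end)
          post≡ = encb-injective post ends s
      in Soundness.derivable-goal {pre = pre} local (trans r (cong (pre ++_) post≡)) q p (read 1F 1 rule₁)

  derivable⇒satisfiable : ∀ θ → Derivable R (map (val θ) goal) →
    ∃ λ (σ : X → List A) → All (σ ⊨_) rootLiterals × C.Refuted σ × ∀ j → σ ⊨ exactly (input-variable j) (θ j)
  derivable⇒satisfiable θ d =
    let ns , local , (pre , p) , q , rest , r , s , t = certificate θ d
        w , e = encb-head rest
        σ = lookupD (encb ns ∷ w ∷ enc pre ∷ tabulate (λ i → replicate (q i) a) ++ [])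
        powers = lookupD-tabulate (λ i → replicate (q i) a) []
        is-power : ∀ i n → q i ≡ n → σ ⊨ exactly (field-variable i) n
        is-power i n = λ { refl → trans (++-identityʳ _) (trans (powers i) (sym (extend-constant σ (replicate (q i) a)))) }
    in σ ,
      ( trans (++-identityʳ (encb ns)) (trans (trans (cong encb r) (trans (encb-++ (encode q) rest)
          (cong₂ _++_ (trans (cong enc (sym (root-val q))) (sym (extend-encᵖ {σ = σ} {field-variable} powers rootTemplate)))
                      (trans e (cong (b ∷_) (sym (++-identityʳ w)))))))
          (sym (extend-++ σ (encᵖ field-variable rootTemplate) _)))
      ∷ trans (++-identityʳ (encb ns)) (trans (cong encb p) (trans (encb-++ pre (encode dummy ++ padding))
          (cong (enc pre ++_) (sym (extend-constant σ (encb (encode dummy ++ padding)))))))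
      ∷ is-power 1F 1 s
      ∷ All.tabulate⁺ {f = fieldLiteral} λ i → powers-commute σ (field-variable i)
          (trans (cong (_++ a ∷ []) (powers i)) (trans (power-commutes (q i)) (cong (a ∷_) (sym (powers i)))))) ,
      C.complete ns refl local ,
      λ j → is-power (field-of (suc zero) j) (θ j) (t j)

-- Diagonalisation

powerCode : ℕ → ℕ → ℕ
powerCode c zero    = 0
powerCode c (suc n) = pair c (powerCode c n)

-- Here `suc (2 * v)` codes the variable `v`, pairing with 0 makes it a one-symbol pattern, and the
-- outer `pair 0` stands for `_≐_`. If `c` codes the letter a, then `powerCode c n` codes its n-th
-- power.
exactlyCode : ℕ → ℕ → ℕ → ℕ
exactlyCode c v n = pair 0 (pair (pair (suc (2 * v)) 0) (powerCode c n))

powerCodeᵣ : ℕ → Rec 1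
powerCodeᵣ c = precᵣ (constᵣ 0) (compᵣ pairᵣ (constᵣ c ∷ projᵣ 1F ∷ []))

powerCode⇓ : ∀ c n → powerCodeᵣ c [ n ∷ [] ]⇓ powerCode c n
powerCode⇓ c zero    = prec⇓-0 (const⇓ 0)
powerCode⇓ c (suc n) = prec⇓-s (powerCode⇓ c n) (comp⇓ (const⇓ c ∷ proj⇓ ∷ []) (pair⇓ c _))

exactlyCodeᵣ : ℕ → ℕ → Rec 1
exactlyCodeᵣ c v = compᵣ pairᵣ (constᵣ 0 ∷
  compᵣ pairᵣ (compᵣ pairᵣ (constᵣ (suc (2 * v)) ∷ constᵣ 0 ∷ []) ∷ powerCodeᵣ c ∷ []) ∷ [])

exactlyCode⇓ : ∀ c v n → exactlyCodeᵣ c v [ n ∷ [] ]⇓ exactlyCode c v n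
exactlyCode⇓ c v n = comp⇓ (const⇓ 0 ∷
  comp⇓ (comp⇓ (const⇓ (suc (2 * v)) ∷ const⇓ 0 ∷ []) (pair⇓ _ _) ∷ powerCode⇓ c n ∷ []) (pair⇓ _ _) ∷ []) (pair⇓ _ _)

-- The code of (e₁ ∷ e₂ ∷ S , U), where e₁ and e₂ fix the values of the variables v₁ and v₂
-- to the codes s of S and u of U.
selfCode : (c v₁ v₂ s u : ℕ) → ℕ
selfCode c v₁ v₂ s u = pair (pair (exactlyCode c v₁ s) (pair (exactlyCode c v₂ u) s)) u

selfCodeᵣ : (c v₁ v₂ : ℕ) → Rec 2
selfCodeᵣ c v₁ v₂ = compᵣ pairᵣ
  (compᵣ pairᵣ (compᵣ (exactlyCodeᵣ c v₁) (projᵣ 0F ∷ []) ∷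
    compᵣ pairᵣ (compᵣ (exactlyCodeᵣ c v₂) (projᵣ 1F ∷ []) ∷ projᵣ 0F ∷ []) ∷ []) ∷ projᵣ 1F ∷ [])

selfCode⇓ : ∀ c v₁ v₂ s u → selfCodeᵣ c v₁ v₂ [ s ∷ u ∷ [] ]⇓ selfCode c v₁ v₂ s u
selfCode⇓ c v₁ v₂ s u = comp⇓
  (comp⇓ (comp⇓ (proj⇓ ∷ []) (exactlyCode⇓ c v₁ s) ∷
    comp⇓ (comp⇓ (proj⇓ ∷ []) (exactlyCode⇓ c v₂ u) ∷ proj⇓ ∷ []) (pair⇓ _ _) ∷ []) (pair⇓ _ _) ∷ proj⇓ ∷ []) (pair⇓ _ _)

-- Defined at (s , u) exactly when the decision procedure f rejects the self-referential system.
rejectsᵣ : Rec 1 → (c v₁ v₂ : ℕ) → Rec 2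
rejectsᵣ f c v₁ v₂ = minᵣ (compᵣ f (compᵣ (selfCodeᵣ c v₁ v₂) (projᵣ 1F ∷ projᵣ 2F ∷ []) ∷ []))

module _ (f : Rec 1) (c v₁ v₂ s u : ℕ) where

  -- The function searched does not depend on the search variable, so the search stops at 0 or
  -- never: minimisation turns the answer 0 into halting.
  rejects⁺ : f [ selfCode c v₁ v₂ s u ∷ [] ]⇓ 0 → rejectsᵣ f c v₁ v₂ [ s ∷ u ∷ [] ]⇓ 0
  rejects⁺ d = min⇓ (comp⇓ (comp⇓ (proj⇓ ∷ proj⇓ ∷ []) (selfCode⇓ c v₁ v₂ s u) ∷ []) d) (λ ())

  rejects⁻ : ∀ {y} → rejectsᵣ f c v₁ v₂ [ s ∷ u ∷ [] ]⇓ y → f [ selfCode c v₁ v₂ s u ∷ [] ]⇓ 0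
  rejects⁻ (min⇓ (comp⇓ (comp⇓ (proj⇓ ∷ proj⇓ ∷ []) d ∷ []) e) _)
    with refl ← ⇓-functional d (selfCode⇓ c v₁ v₂ s u) = e

module Diagonal {A : Set} {k : ℕ} (enum : A ↔ Fin (2 + k)) where
  open Alphabet enum using (a; exactly)

  letterCode : ℕ
  letterCode = 2 * code-letter enum a

  code-exactly : ∀ v n → code-Literal enum id (exactly v n) ≡ exactlyCode letterCode v n
  code-exactly v n = cong (λ m → pair 0 (pair (pair (suc (2 * v)) 0) m)) (power n)
    where
    power : ∀ n → code-Pattern enum id (map inj₁ (replicate n a)) ≡ powerCode letterCode n
    power zero    = refl
    power (suc n) = cong (pair letterCode) (power n)

  withInputs : X → X → ℕ → ℕ → System A → System A
  withInputs v₁ v₂ m n (system S U) = system (exactly v₁ m ∷ exactly v₂ n ∷ S) U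

  Represents : X → X → Rec 2 → System A → Set
  Represents v₁ v₂ h T = ∀ m n →
    (Satisfiable (withInputs v₁ v₂ m n T) → ∃ λ y → h [ m ∷ n ∷ [] ]⇓ y) ×
    (∀ {y} → h [ m ∷ n ∷ [] ]⇓ y → Satisfiable (withInputs v₁ v₂ m n T))

  -- No case distinction on satisfiability of `self` is made. Satisfiability would give `f` the two
  -- values 1 and 0; its refutation makes `f` answer 0, so `h` halts and `self` is satisfiable after
  -- all.
  undecidable : ∀ v₁ v₂ → (∀ h → ∃ (Represents v₁ v₂ h)) → Undecidable (code-System enum) Satisfiable
  undecidable v₁ v₂ represent (f , decides) = not-satisfiable is-satisfiable
    where
    h = rejectsᵣ f letterCode v₁ v₂
    T = proj₁ (represent h)
    s = code-List (code-Literal enum id) (System.sat T)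
    u = code-List (code-Literal enum (code-⊎ id id)) (System.unsat T)
    self = withInputs v₁ v₂ s u T

    code-self : code-System enum self ≡ selfCode letterCode v₁ v₂ s u
    code-self = cong₂ (λ l₁ l₂ → pair (pair l₁ (pair l₂ s)) u) (code-exactly v₁ s) (code-exactly v₂ u)

    not-satisfiable : ¬ Satisfiable self
    not-satisfiable sat = contradiction
      (⇓-functional (proj₁ (decides self) sat) (subst (λ n → f [ n ∷ [] ]⇓ 0) (sym code-self)
        (rejects⁻ f letterCode v₁ v₂ s u (proj₂ (proj₁ (proj₂ (represent h) s u) sat))))) λ ()

    is-satisfiable : Satisfiable self
    is-satisfiable = proj₂ (proj₂ (represent h) s u)
      (rejects⁺ f letterCode v₁ v₂ s u (subst (λ n → f [ n ∷ [] ]⇓ 0) code-self (proj₂ (decides self) not-satisfiable)))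

module _ {A : Set} {k : ℕ} (enum : A ↔ Fin (2 + k)) where
  open Diagonal enum

  -- The empty path is the position of the function itself; variable 0 is its unknown value,
  -- variables 1 and 2 are the inputs.
  goal : List (Lin (Fin 3))
  goal = lit (tag []) ∷ var 0F ∷ var 1F ∷ var 2F ∷ []

  -- The inputs are variables 1 and 2 of the root rule, hence fields 7 and 8, hence variables 10 and 11 of X.
  represent : ∀ h → ∃ (Represents 10 11 h)
  represent h = system rootLiterals clause , λ m n → halts m n , satisfiable m n
    where
    R = rules h []
    open Reduction enum R goal using (rootLiterals; clause; satisfiable⇒derivable; derivable⇒satisfiable)

    halts : ∀ m n → Satisfiable (withInputs 10 11 m n (system rootLiterals clause)) → ∃ λ y → h [ m ∷ n ∷ [] ]⇓ y
    halts m n (σ , (e₁ ∷ e₂ ∷ root) , refuted) =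
      let θ , inputs , d = satisfiable⇒derivable root refuted
      in θ 0F , derivable⇒⇓ {f = h} {xs = m ∷ n ∷ []}
        (subst₂ (λ m n → Derivable R (tag [] ∷ θ 0F ∷ m ∷ n ∷ [])) (inputs 1F m e₁) (inputs 2F n e₂) d)

    satisfiable : ∀ m n {y} → h [ m ∷ n ∷ [] ]⇓ y → Satisfiable (withInputs 10 11 m n (system rootLiterals clause))
    satisfiable m n {y} d =
      let σ , root , refuted , inputs = derivable⇒satisfiable (List.lookup (y ∷ m ∷ n ∷ [])) (⇓⇒derivable d [] id)
      in σ , (inputs 1F ∷ inputs 2F ∷ root) , refuted

mainTheorem4 : (A : Set) (k : ℕ) (enum : A ↔ Fin k) → 2 ≤ k →
    Undecidable (code-System enum) Satisfiable
mainTheorem4 A (suc (suc k)) enum (s≤s (s≤s z≤n)) = Diagonal.undecidable enum 10 11 (represent enum)
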